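{- There is an absolute constant $K>0$ such that for every integer $n\ge 2$ and every real $\varepsilon\in[3\log n/n,\,1]$ there exists an online algorithm for the online sorting problem with unknown range that inserts any sequence of $n$ elements into an array with at most $(1+\varepsilon)n$ cells and is $K\frac{\log^3 n}{\varepsilon}$-competitive; that is, there exists an $O\left(\frac{\log^3 n}{\varepsilon}\right)$-competitive algorithm using $(1+\varepsilon)n$ space.
   Context: Logarithms are base $2$. Online sorting problem with unknown range: a sequence of $n$ real numbers (elements) arrives one at a time; $n$ and the array size are known in advance, but neither the elements nor any bounds on their range are known in advance (and there are no sentinel elements). When an element arrives, the algorithm must immediately and irrevocably place it in an empty cell of the array (each cell holds at most one element). The cost of the solution is the sum of $|x-y|$ over all pairs $x,y$ of elements occupying consecutive non-empty cells (non-empty cells with no non-empty cell between them) after all elements have been inserted. The optimal cost $\mathsf{opt}$ is the difference between the largest and the smallest element of the sequence. An algorithm is $\rho$-competitive if on every input sequence its cost is at most $\rho\cdot\mathsf{opt}$. All algorithms are deterministic. -}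

module Defs where

open import Algebra.Bundles using (CommutativeRing; Semiring)
open import Algebra.Structures using (IsCommutativeRing)
open import Data.Fin.Base using (Fin)
open import Data.List.Base using (List; []; _∷_; _∷ʳ_; catMaybes)
open import Data.Maybe.Base using (Maybe; just; nothing)
open import Data.Nat.Base as ℕ using (ℕ; zero; suc)
import Data.Nat.Properties as ℕ
open import Data.Product.Base using (∃; ∃₂; _×_; _,_; proj₁)
open import Data.Sum.Base using (inj₁; inj₂)
open import Data.Vec.Base as Vec using (Vec; []; _∷_; lookup; replicate; toList; _[_]≔_)
open import Level using (0ℓ)
open import Relation.Binary.Bundles using (TotalOrder)
open import Relation.Binary.Structures using (IsDecTotalOrder)
open import Relation.Binary.PropositionalEquality
open import Relation.Nullary.Decidable using (yes; no)
open import Relation.Nullary.Negation using (contradiction)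

-- The classical real numbers, axiomatised as a Dedekind-complete ordered field
-- (which determines them up to isomorphism).  Equality and order are decidable,
-- so an algorithm may branch on comparisons between elements.
-- The inverse is total; nothing is assumed about 0# ⁻¹.

record RealNumbers : Set₁ where
  infix  8 _⁻¹
  infix  8 -_
  infixl 7 _*_
  infixl 6 _+_
  infix  4 _≤_
  field
    ℝ   : Set
    _+_ : ℝ → ℝ → ℝ
    _*_ : ℝ → ℝ → ℝ
    -_  : ℝ → ℝ
    0#  : ℝ
    1#  : ℝ
    _⁻¹ : ℝ → ℝ
    _≤_ : ℝ → ℝ → Set

    isCommutativeRing : IsCommutativeRing _≡_ _+_ _*_ -_ 0# 1#
    0≢1               : 0# ≢ 1#
    *-inverseʳ        : ∀ x → x ≢ 0# → x * x ⁻¹ ≡ 1#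

    isDecTotalOrder   : IsDecTotalOrder _≡_ _≤_
    +-monoˡ-≤         : ∀ z {x y} → x ≤ y → x + z ≤ y + z
    *-nonNeg          : ∀ {x y} → 0# ≤ x → 0# ≤ y → 0# ≤ x * y

  UpperBound : (ℝ → Set) → ℝ → Set
  UpperBound P b = ∀ x → P x → x ≤ b

  Supremum : (ℝ → Set) → ℝ → Set
  Supremum P s = UpperBound P s × (∀ b → UpperBound P b → s ≤ b)

  field
    complete : (P : ℝ → Set) → ∃ P → ∃ (UpperBound P) → ∃ (Supremum P)

module Real (R : RealNumbers) where
  open RealNumbers R public

  commutativeRing : CommutativeRing 0ℓ 0ℓ
  commutativeRing = record { isCommutativeRing = isCommutativeRing }

  totalOrder : TotalOrder 0ℓ 0ℓ 0ℓ
  totalOrder = record { isTotalOrder = IsDecTotalOrder.isTotalOrder isDecTotalOrder }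

  open CommutativeRing commutativeRing public using (_-_)
  open import Algebra.Definitions.RawSemiring
    (Semiring.rawSemiring (CommutativeRing.semiring commutativeRing)) public
    using (_^_) renaming (_×_ to _·_)
  open import Algebra.Construct.NaturalChoice.Max totalOrder public using (_⊔_)
  open import Algebra.Construct.NaturalChoice.Min totalOrder public using (_⊓_)
  open import Relation.Binary.Construct.NonStrictToStrict _≡_ _≤_ public using (_<_)

  infixl 7 _/_
  _/_ : ℝ → ℝ → ℝ
  x / y = x * y ⁻¹

  ∣_∣ : ℝ → ℝ
  ∣ x ∣ = x ⊔ (- x)

  fromℕ : ℕ → ℝ
  fromℕ n = n · 1#

  -- The rationals p / q with 2 ^ (p / q) ≤ n, where 0 < q.
  BelowLog₂ : ℕ → ℝ → Set
  BelowLog₂ n r = ∃₂ λ p q →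
    0 ℕ.< q × (2 ℕ.^ p ℕ.≤ n ℕ.^ q) × r ≡ fromℕ p / fromℕ q

  module Properties where
    open CommutativeRing commutativeRing
      using (+-comm; +-identityˡ; +-identityʳ; -‿inverseʳ; *-assoc; *-comm;
             *-identityʳ; zeroʳ; ring; semiring)
    open import Algebra.Properties.Ring ring using (-‿distribˡ-*; -‿distribʳ-*; -‿involutive)
    open import Algebra.Properties.Semiring.Mult semiring using (×1-homo-*)
    module O = IsDecTotalOrder isDecTotalOrder

    neg≥0 : ∀ {x} → x ≤ 0# → 0# ≤ - x
    neg≥0 {x} h = subst₂ _≤_ (-‿inverseʳ x) (+-identityˡ (- x)) (+-monoˡ-≤ (- x) h)

    sub≥0 : ∀ {x y} → x ≤ y → 0# ≤ y - x
    sub≥0 {x} {y} h = subst (_≤ y - x) (-‿inverseʳ x) (+-monoˡ-≤ (- x) h)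

    neg≤0 : ∀ {x} → 0# ≤ - x → x ≤ 0#
    neg≤0 h = subst (_≤ 0#) (-‿involutive _)
      (subst₂ _≤_ (+-identityˡ _) (-‿inverseʳ _) (+-monoˡ-≤ _ h))

    1≥0 : 0# ≤ 1#
    1≥0 with O.total 0# 1#
    ... | inj₁ h = h
    ... | inj₂ h = subst (0# ≤_) eq (*-nonNeg (neg≥0 h) (neg≥0 h))
      where
      eq : (- 1#) * (- 1#) ≡ 1#
      eq = trans (sym (-‿distribˡ-* 1# (- 1#)))
          (trans (cong -_ (sym (-‿distribʳ-* 1# 1#)))
          (trans (-‿involutive _) (*-identityʳ 1#)))

    fromℕ-step : ∀ n → fromℕ n ≤ fromℕ (suc n)
    fromℕ-step n = subst (_≤ fromℕ (suc n)) (+-identityˡ _) (+-monoˡ-≤ (fromℕ n) 1≥0)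

    fromℕ≥0 : ∀ n → 0# ≤ fromℕ n
    fromℕ≥0 zero    = O.refl
    fromℕ≥0 (suc n) = O.trans (fromℕ≥0 n) (fromℕ-step n)

    fromℕ-suc≢0 : ∀ n → fromℕ (suc n) ≢ 0#
    fromℕ-suc≢0 n eq = 0≢1 (O.antisym 1≥0 (subst (1# ≤_) eq 1≤))
      where
      1≤ : 1# ≤ fromℕ (suc n)
      1≤ = subst₂ _≤_ (+-identityˡ 1#) (+-comm (fromℕ n) 1#) (+-monoˡ-≤ 1# (fromℕ≥0 n))

    fromℕ-mono : ∀ {m n} → m ℕ.≤′ n → fromℕ m ≤ fromℕ n
    fromℕ-mono             (ℕ.≤′-reflexive refl) = O.refl
    fromℕ-mono {n = suc n} (ℕ.≤′-step h)         = O.trans (fromℕ-mono h) (fromℕ-step n)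

    inv≥0 : ∀ {x} → 0# ≤ x → x ≢ 0# → 0# ≤ x ⁻¹
    inv≥0 {x} x≥0 x≢0 with O.total 0# (x ⁻¹)
    ... | inj₁ h = h
    ... | inj₂ h = contradiction (O.antisym 1≥0 (neg≤0 (subst (0# ≤_) eq (*-nonNeg x≥0 (neg≥0 h))))) 0≢1
      where
      eq : x * (- (x ⁻¹)) ≡ - 1#
      eq = trans (sym (-‿distribʳ-* x (x ⁻¹))) (cong -_ (*-inverseʳ x x≢0))

    *-monoʳ : ∀ {x y z} → 0# ≤ z → x ≤ y → x * z ≤ y * z
    *-monoʳ {x} {y} {z} z≥0 h =
      subst₂ _≤_ (+-identityˡ (x * z)) eq (+-monoˡ-≤ (x * z) (*-nonNeg (sub≥0 h) z≥0))
      where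
      open CommutativeRing commutativeRing using (distribʳ; +-assoc; -‿inverseˡ)
      eq : (y - x) * z + x * z ≡ y * z
      eq = trans (sym (distribʳ z (y - x) x))
             (cong (_* z) (trans (+-assoc y (- x) x)
                          (trans (cong (y +_) (-‿inverseˡ x)) (+-identityʳ y))))

    n≤2^n : ∀ n → n ℕ.≤ 2 ℕ.^ n
    n≤2^n zero    = ℕ.z≤n
    n≤2^n (suc n) = ℕ.+-mono-≤ (ℕ.m^n>0 2 n)
      (subst (n ℕ.≤_) (sym (ℕ.+-identityʳ _)) (n≤2^n n))

    exponent-bound : ∀ n p q → 2 ℕ.^ p ℕ.≤ n ℕ.^ q → p ℕ.≤ n ℕ.* q
    exponent-bound n p q h with p ℕ.≤? n ℕ.* q
    ... | yes p≤nq = p≤nq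
    ... | no  p≰nq = contradiction
      (ℕ.≤-trans h (ℕ.≤-trans (ℕ.^-monoˡ-≤ q (n≤2^n n)) (ℕ.≤-reflexive (ℕ.^-*-assoc 2 n q))))
      (ℕ.<⇒≱ (ℕ.^-monoʳ-< 2 (ℕ.s≤s (ℕ.s≤s ℕ.z≤n)) (ℕ.≰⇒> p≰nq)))

    belowLog₂-bounded : ∀ n → UpperBound (BelowLog₂ n) (fromℕ n)
    belowLog₂-bounded n _ (p , q@(suc k) , _ , h , refl) =
      subst (fromℕ p / fromℕ q ≤_) eq
        (*-monoʳ (inv≥0 (fromℕ≥0 q) (fromℕ-suc≢0 k))
          (fromℕ-mono (ℕ.≤⇒≤′ (exponent-bound n p q h))))
      where
      eq : fromℕ (n ℕ.* q) / fromℕ q ≡ fromℕ n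
      eq = trans (cong (_/ fromℕ q) (×1-homo-* n q))
          (trans (*-assoc _ _ _)
          (trans (cong (fromℕ n *_) (*-inverseʳ _ (fromℕ-suc≢0 k))) (*-identityʳ _)))

  log₂-sup : ∀ n → ∃ (Supremum (BelowLog₂ (suc n)))
  log₂-sup n = complete (BelowLog₂ (suc n))
    (_ , 0 , 1 , ℕ.s≤s ℕ.z≤n , ℕ.s≤s ℕ.z≤n , refl)
    (_ , Properties.belowLog₂-bounded (suc n))

  -- log₂ n is the supremum of the rationals r with 2 ^ r ≤ n.  Only nonnegative
  -- rationals are needed since n ≥ 1; the value at 0 is a dummy.
  log₂ : ℕ → ℝ
  log₂ zero    = 0#
  log₂ (suc n) = proj₁ (log₂-sup n)

module OnlineSorting (R : RealNumbers) where
  open Real R public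

  Array : ℕ → Set
  Array m = Vec (Maybe ℝ) m

  -- A deterministic online algorithm maps the elements that arrived earlier (in
  -- order of arrival) and the arriving element to the cell for that element.  Its
  -- own earlier placements are a function of the earlier elements, so they are not
  -- a separate argument.
  Algorithm : ℕ → Set
  Algorithm m = List ℝ → ℝ → Fin m

  -- Run alg h A xs B: with h already arrived and array contents A, the algorithm
  -- places the elements xs one by one, each in a cell empty at that time, and ends
  -- with contents B.
  data Run {m} (alg : Algorithm m) (h : List ℝ) (A : Array m) :
           List ℝ → Array m → Set where
    done   : Run alg h A [] A
    insert : ∀ {x xs B} →
             lookup A (alg h x) ≡ nothing →
             Run alg (h ∷ʳ x) (A [ alg h x ]≔ just x) xs B →
             Run alg h A (x ∷ xs) B

  variation : List ℝ → ℝ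
  variation []           = 0#
  variation (x ∷ [])     = 0#
  variation (x ∷ y ∷ ys) = ∣ x - y ∣ + variation (y ∷ ys)

  cost : ∀ {m} → Array m → ℝ
  cost A = variation (catMaybes (toList A))

  opt : ∀ {n} → Vec ℝ n → ℝ
  opt []       = 0#
  opt (x ∷ xs) = Vec.foldr′ _⊔_ x xs - Vec.foldr′ _⊓_ x xs

  Competitive : ∀ {m} → ℕ → Algorithm m → ℝ → Set
  Competitive {m} n alg ρ = (xs : Vec ℝ n) →
    ∃ λ (B : Array m) →
      Run alg [] (replicate m nothing) (toList xs) B × cost B ≤ ρ * opt xs

{-# OPTIONS --safe #-}
module Submission where

-- Every element x keeps up to two private runs ("gaps") of 2 ^ j ∸ 1 free cells, one on
-- each side.  Let t be the number of elements since the last restart and D the range at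
-- that restart.  A new element y at distance at most δ_j ~ 2 ^ j * D * log n / (ε t) from
-- the owner of a gap of level j may be placed in the middle of that gap, splitting it into
-- two gaps of level j ∸ 1 owned by y; the lowest possible level is used.  Hence owners of
-- gaps of equal level (and side) are pairwise more than a threshold apart, so if y fits
-- nowhere, a packing argument over the O(log n) levels shows that at most ε t / 2 cells
-- are free, and y opens fresh gaps of at most ε t / 2 further cells at the end.  When the
-- range exceeds 2 D, all gaps are abandoned and the scheme restarts, so that the abandoned
-- cells, too, number at most ε times the elements.
-- Splitting at level j costs O(δ_j), which is paid by the drop of the potential Σ j 2 ^ j
-- over all gaps; opening fresh cells is paid by a budget that grows by O(D log² n / ε)
-- whenever t doubles.  As D at least doubles at a restart, the total cost is a geometric
-- sum dominated by its last term, O(D log³ n / ε).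

open import Defs
open import Algebra.Bundles using (CommutativeRing)
import Algebra.Properties.Ring as RingProperties
import Algebra.Properties.Semiring.Mult as SemiringMult
import Algebra.Solver.Ring.NaturalCoefficients.Default as SemiringSolver
open import Data.Bool.Base using (true; false)
open import Data.Fin.Base as Fin using (Fin; toℕ; fromℕ<)
import Data.Fin.Properties as Fin
open import Data.List.Base using (List; []; _∷_; _++_; [_]; _∷ʳ_; map; foldl; length; filter; replicate; catMaybes; concatMap; initLast; _∷ʳ′_)
import Data.List.Properties as List
open import Data.List.Relation.Binary.Permutation.Propositional using (↭-sym; ↭⇒↭ₛ)
open import Data.List.Relation.Binary.Permutation.Propositional.Properties using (All-resp-↭; ↭-length)
import Data.List.Relation.Binary.Permutation.Setoid.Properties as SetoidPermutation
open import Data.List.Relation.Unary.All as All using (All; []; _∷_)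
import Data.List.Relation.Unary.All.Properties as All
open import Data.List.Relation.Unary.AllPairs as AllPairs using (AllPairs; []; _∷_)
import Data.List.Relation.Unary.AllPairs.Properties as AllPairs
import Data.List.Relation.Unary.Sorted.TotalOrder.Properties as Sorted
import Data.List.Sort as Sort
open import Data.Maybe.Base using (Maybe; just; nothing)
open import Data.Nat.Base as ℕ using (ℕ; zero; suc)
import Data.Nat.DivMod as ℕ
open import Data.Nat.ListAction using (sum)
open import Data.Nat.ListAction.Properties using (sum-++)
import Data.Nat.Properties as ℕ
open import Data.Nat.Tactic.RingSolver using (solve-∀)
open import Data.Product.Base using (∃; ∃₂; _×_; _,_; proj₁; proj₂)
open import Data.Sum.Base using (_⊎_; inj₁; inj₂)
open import Data.Vec.Base as Vec using (Vec; []; _∷_; lookup; _[_]≔_; toList)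
import Data.Vec.Properties as Vec
open import Function.Base using (_∘_)
open import Relation.Binary.Bundles using (DecTotalOrder)
open import Relation.Binary.PropositionalEquality hiding ([_])
import Relation.Binary.Reasoning.PartialOrder as PosetReasoning
open import Relation.Nullary.Decidable using (Dec; yes; no; does; ¬?)
open import Relation.Nullary.Negation using (¬_; contradiction)

-- Arithmetic in an ordered field.

module OrderedField (R : RealNumbers) where
  open OnlineSorting R public
  open Properties public hiding (module O)
  open CommutativeRing commutativeRing public
    using (+-comm; +-assoc; +-identityˡ; +-identityʳ; -‿inverseʳ; -‿inverseˡ; *-comm; *-assoc; *-identityˡ;
           *-identityʳ; distribʳ; distribˡ; zeroˡ; zeroʳ)
  open CommutativeRing commutativeRing using (ring; semiring; commutativeSemiring)
  open RingProperties ring using (-‿involutive; -‿+-comm)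
  open import Algebra.Construct.NaturalChoice.Max totalOrder public
    using (x≤x⊔y; x≤y⊔x; ⊔-lub; ⊔-comm)
  open import Algebra.Construct.NaturalChoice.Min totalOrder public
    using (x⊓y≤x; x⊓y≤y; ⊓-glb)
  open SemiringMult semiring using (×1-homo-*; ×-homo-+)
  open SemiringSolver commutativeSemiring public
    using (solve; _:+_; _:*_; _:=_; con)

  decTotalOrder : DecTotalOrder _ _ _
  decTotalOrder = record { isDecTotalOrder = isDecTotalOrder }

  open DecTotalOrder decTotalOrder public
    using (_≤?_; antisym)
    renaming (total to ≤-total; refl to ≤-refl; trans to ≤-trans; reflexive to ≤-reflexive)

  module ≤-Reasoning = PosetReasoning (DecTotalOrder.poset decTotalOrder)

  ≰⇒≥ : ∀ {x y} → ¬ x ≤ y → y ≤ x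
  ≰⇒≥ {x} {y} x≰y with ≤-total x y
  ... | inj₁ x≤y = contradiction x≤y x≰y
  ... | inj₂ y≤x = y≤x

  +-mono-≤ : ∀ {a b c d} → a ≤ b → c ≤ d → a + c ≤ b + d
  +-mono-≤ {a} {b} {c} {d} a≤b c≤d = ≤-trans (+-monoˡ-≤ c a≤b)
    (subst₂ _≤_ (+-comm c b) (+-comm d b) (+-monoˡ-≤ b c≤d))

  +-monoʳ-≤ : ∀ z {x y} → x ≤ y → z + x ≤ z + y
  +-monoʳ-≤ z = +-mono-≤ ≤-refl

  +-cancelʳ-≤ : ∀ z {x y} → x + z ≤ y + z → x ≤ y
  +-cancelʳ-≤ z {x} {y} le = subst₂ _≤_ (undo x) (undo y) (+-monoˡ-≤ (- z) le)
    where
    undo : ∀ w → (w + z) - z ≡ w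
    undo w = trans (+-assoc w z (- z)) (trans (cong (w +_) (-‿inverseʳ z)) (+-identityʳ w))

  *-monoˡ : ∀ {x y z} → 0# ≤ z → x ≤ y → z * x ≤ z * y
  *-monoˡ {x} {y} {z} z≥0 x≤y = subst₂ _≤_ (*-comm x z) (*-comm y z) (*-monoʳ z≥0 x≤y)

  *-mono-≤ : ∀ {a b c d} → 0# ≤ b → 0# ≤ c → a ≤ b → c ≤ d → a * c ≤ b * d
  *-mono-≤ b≥0 c≥0 a≤b c≤d = ≤-trans (*-monoʳ c≥0 a≤b) (*-monoˡ b≥0 c≤d)

  x-y+y≡x : ∀ x y → (x - y) + y ≡ x
  x-y+y≡x x y = trans (+-assoc x (- y) y) (trans (cong (x +_) (-‿inverseˡ y)) (+-identityʳ x))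

  x-y≤z : ∀ {x y z} → x ≤ z + y → x - y ≤ z
  x-y≤z {x} {y} {z} le = +-cancelʳ-≤ y (subst (_≤ z + y) (sym (x-y+y≡x x y)) le)

  x≤z+y : ∀ {x y z} → x - y ≤ z → x ≤ z + y
  x≤z+y {x} {y} {z} le = subst (_≤ z + y) (x-y+y≡x x y) (+-monoˡ-≤ y le)

  -‿sub : ∀ x y → - (x - y) ≡ y - x
  -‿sub x y = trans (sym (-‿+-comm x (- y)))
    (trans (cong (- x +_) (-‿involutive y)) (+-comm (- x) y))

  ∣x-y∣≡∣y-x∣ : ∀ x y → ∣ x - y ∣ ≡ ∣ y - x ∣
  ∣x-y∣≡∣y-x∣ x y = trans (⊔-comm (x - y) (- (x - y)))
    (cong₂ _⊔_ (-‿sub x y) (sym (-‿sub y x)))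

  ∣x-y∣≤z : ∀ {x y z} → x ≤ z + y → y ≤ z + x → ∣ x - y ∣ ≤ z
  ∣x-y∣≤z {x} {y} p q = ⊔-lub (x-y≤z p) (subst (_≤ _) (sym (-‿sub x y)) (x-y≤z q))

  x≤∣x-y∣+y : ∀ x y → x ≤ ∣ x - y ∣ + y
  x≤∣x-y∣+y x y = x≤z+y (x≤x⊔y (x - y) (- (x - y)))

  y≤∣x-y∣+x : ∀ x y → y ≤ ∣ x - y ∣ + x
  y≤∣x-y∣+x x y = subst (λ d → y ≤ d + x) (∣x-y∣≡∣y-x∣ y x) (x≤∣x-y∣+y y x)

  0≤∣x-y∣ : ∀ x y → 0# ≤ ∣ x - y ∣
  0≤∣x-y∣ x y with ≤-total x y
  ... | inj₁ x≤y = ≤-trans (sub≥0 x≤y) (subst (y - x ≤_) (∣x-y∣≡∣y-x∣ y x) (x≤x⊔y (y - x) _))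
  ... | inj₂ y≤x = ≤-trans (sub≥0 y≤x) (x≤x⊔y (x - y) _)

  triangle : ∀ x y z → ∣ x - z ∣ ≤ ∣ x - y ∣ + ∣ y - z ∣
  triangle x y z = ∣x-y∣≤z
    (≤-trans (x≤∣x-y∣+y x y) (≤-trans (+-monoʳ-≤ _ (x≤∣x-y∣+y y z))
      (≤-reflexive (sym (+-assoc _ _ _)))))
    (≤-trans (y≤∣x-y∣+x y z) (≤-trans (+-monoʳ-≤ _ (y≤∣x-y∣+x x y))
      (≤-reflexive (solve 3 (λ a b c → a :+ (b :+ c) := (b :+ a) :+ c) refl _ _ _))))

  ∣x-y∣≤hi-lo : ∀ {lo hi x y} → lo ≤ x → x ≤ hi → lo ≤ y → y ≤ hi → ∣ x - y ∣ ≤ hi - lo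
  ∣x-y∣≤hi-lo {lo} {hi} lo≤x x≤hi lo≤y y≤hi = ∣x-y∣≤z (bound x≤hi lo≤y) (bound y≤hi lo≤x)
    where
    bound : ∀ {u v} → u ≤ hi → lo ≤ v → u ≤ (hi - lo) + v
    bound u≤hi lo≤v = ≤-trans u≤hi
      (≤-trans (≤-reflexive (sym (x-y+y≡x hi lo))) (+-monoʳ-≤ (hi - lo) lo≤v))

  fromℕ-+ : ∀ m n → fromℕ (m ℕ.+ n) ≡ fromℕ m + fromℕ n
  fromℕ-+ m n = ×-homo-+ 1# m n

  fromℕ-* : ∀ m n → fromℕ (m ℕ.* n) ≡ fromℕ m * fromℕ n
  fromℕ-* = ×1-homo-*

  fromℕ-1 : fromℕ 1 ≡ 1#
  fromℕ-1 = +-identityʳ 1#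

  fromℕ-mono-≤ : ∀ {m n} → m ℕ.≤ n → fromℕ m ≤ fromℕ n
  fromℕ-mono-≤ m≤n = fromℕ-mono (ℕ.≤⇒≤′ m≤n)

  fromℕ-*-mono : ∀ {m n x} → 0# ≤ x → m ℕ.≤ n → fromℕ m * x ≤ fromℕ n * x
  fromℕ-*-mono x≥0 m≤n = *-monoʳ x≥0 (fromℕ-mono-≤ m≤n)

  fromℕ-*-cancel : ∀ {m n x} → ¬ (x ≤ 0#) → fromℕ m * x ≤ fromℕ n * x → m ℕ.≤ n
  fromℕ-*-cancel {m} {n} {x} x≰0 le with m ℕ.≤? n
  ... | yes m≤n = m≤n
  ... | no m≰n = contradiction (+-cancelʳ-≤ (fromℕ n * x) (begin
    x + fromℕ n * x           ≡⟨ solve 2 (λ x n → x :+ n :* x := (con 1 :+ n) :* x) refl x (fromℕ n) ⟩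
    fromℕ (suc n) * x         ≤⟨ fromℕ-*-mono (≰⇒≥ x≰0) (ℕ.≰⇒> m≰n) ⟩
    fromℕ m * x               ≤⟨ le ⟩
    fromℕ n * x               ≡⟨ sym (+-identityˡ _) ⟩
    0# + fromℕ n * x          ∎)) x≰0
    where open ≤-Reasoning

  double : ∀ x → fromℕ 2 * x ≡ x + x
  double x = trans (cong (_* x) (cong (1# +_) fromℕ-1))
    (trans (distribʳ x 1# 1#) (cong₂ _+_ (*-identityˡ x) (*-identityˡ x)))

  -- Variation of sequences and packing of points on the line.

  variation-snoc : ∀ {d} xs x y → ∣ x - y ∣ ≤ d →
    variation ((xs ++ [ x ]) ++ [ y ]) ≤ variation (xs ++ [ x ]) + d
  variation-snoc {d} [] x y le =
    subst₂ _≤_ (sym (+-identityʳ _)) (sym (+-identityˡ _)) le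
  variation-snoc (a ∷ []) x y le = ≤-trans (+-monoʳ-≤ _ (variation-snoc [] x y le))
    (≤-reflexive (sym (+-assoc _ _ _)))
  variation-snoc (a ∷ b ∷ xs) x y le = ≤-trans (+-monoʳ-≤ _ (variation-snoc (b ∷ xs) x y le))
    (≤-reflexive (sym (+-assoc _ _ _)))

  -- Distance at least `Z / κ`, with the division cleared so that bounds on integers can be read off
  -- later.
  Spread : ℝ → ℝ → ℝ → ℝ → Set
  Spread κ Z x y = Z ≤ κ * ∣ x - y ∣

  Spread-sym : ∀ {κ Z x y} → Spread κ Z x y → Spread κ Z y x
  Spread-sym {κ} {Z} {x} {y} = subst (λ d → Z ≤ κ * d) (∣x-y∣≡∣y-x∣ x y)

  Spread-shift : ∀ {κ Z x y} → 0# ≤ κ → x ≤ y → Spread κ Z x y → Z + κ * x ≤ κ * y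
  Spread-shift {κ} {Z} {x} {y} κ≥0 x≤y far = begin
    Z + κ * x               ≤⟨ +-monoˡ-≤ (κ * x) far ⟩
    κ * ∣ x - y ∣ + κ * x   ≡⟨ sym (distribˡ κ _ x) ⟩
    κ * (∣ x - y ∣ + x)     ≤⟨ *-monoˡ κ≥0 (+-monoˡ-≤ x (∣x-y∣≤hi-lo ≤-refl x≤y x≤y ≤-refl)) ⟩
    κ * ((y - x) + x)       ≡⟨ cong (κ *_) (x-y+y≡x y x) ⟩
    κ * y                   ∎
    where open ≤-Reasoning

  private
    -- In increasing order each point raises the floor `ℓ` for the points after it by `Z`, and the
    -- floor never passes `κ * hi + Z`. The last hypothesis serves the empty list, where no point
    -- witnesses the bound on `ℓ`.
    sorted-packing : ∀ {κ Z hi} ℓ zs → 0# ≤ κ →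
      AllPairs _≤_ zs → AllPairs (Spread κ Z) zs → All (_≤ hi) zs → All (λ z → ℓ ≤ κ * z) zs →
      ℓ ≤ κ * hi + Z → fromℕ (length zs) * Z + ℓ ≤ κ * hi + Z
    sorted-packing {Z = Z} ℓ [] _ _ _ _ _ ℓ≤ = subst (_≤ _)
      (sym (trans (cong (_+ ℓ) (zeroˡ Z)) (+-identityˡ ℓ))) ℓ≤
    sorted-packing {κ} {Z} {hi} ℓ (z ∷ zs) κ≥0 (z≤ ∷ inc) (far ∷ spread) (z≤hi ∷ ≤hi) (ℓ≤z ∷ _) _ = begin
      fromℕ (suc n) * Z + ℓ         ≡⟨ solve 3 (λ n Z ℓ → (con 1 :+ n) :* Z :+ ℓ := n :* Z :+ (Z :+ ℓ)) refl (fromℕ n) Z ℓ ⟩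
      fromℕ n * Z + (Z + ℓ)         ≤⟨ +-monoʳ-≤ _ (+-monoʳ-≤ Z ℓ≤z) ⟩
      fromℕ n * Z + (Z + κ * z)     ≤⟨ sorted-packing (Z + κ * z) zs κ≥0 inc spread ≤hi
                                         (All.zipWith (λ (le , s) → Spread-shift κ≥0 le s) (z≤ , far))
                                         (≤-trans (≤-reflexive (+-comm Z _)) (+-monoˡ-≤ Z (*-monoˡ κ≥0 z≤hi))) ⟩
      κ * hi + Z                    ∎
      where
      open ≤-Reasoning
      n = length zs

  -- Sorted, the points leave `length zs` intervals between neighbours, each of length at least
  -- `Z / κ`. The extra point `y` absorbs the off-by-one.
  packing : ∀ {κ Z lo hi} y zs → 0# ≤ κ → 0# ≤ Z → AllPairs (Spread κ Z) (y ∷ zs) →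
    All (λ z → lo ≤ z × z ≤ hi) (y ∷ zs) → fromℕ (length zs) * Z ≤ κ * (hi - lo)
  packing {κ} {Z} {lo} {hi} y zs κ≥0 Z≥0 spread within@((lo≤y , y≤hi) ∷ _) =
    +-cancelʳ-≤ (Z + κ * lo) (begin
      fromℕ n * Z + (Z + κ * lo)         ≡⟨ solve 3 (λ n Z ℓ → n :* Z :+ (Z :+ ℓ) := (con 1 :+ n) :* Z :+ ℓ) refl (fromℕ n) Z (κ * lo) ⟩
      fromℕ (suc n) * Z + κ * lo         ≡⟨ cong (λ k → fromℕ k * Z + κ * lo) (sym (↭-length (sort-↭ (y ∷ zs)))) ⟩
      fromℕ (length ws) * Z + κ * lo     ≤⟨ sorted-packing (κ * lo) ws κ≥0
                                             (Sorted.Sorted⇒AllPairs totalOrder (sort-↗ (y ∷ zs)))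
                                             (SetoidPermutation.AllPairs-resp-↭ (setoid ℝ)
                                               (Spread-sym {κ} {Z}) (resp₂ (Spread κ Z)) (↭⇒↭ₛ (↭-sym (sort-↭ (y ∷ zs)))) spread)
                                             (All.map proj₂ within′) (All.map (λ w → *-monoˡ κ≥0 (proj₁ w)) within′)
                                             lo≤ ⟩
      κ * hi + Z                         ≡⟨ cong (λ h → κ * h + Z) (sym (x-y+y≡x hi lo)) ⟩
      κ * ((hi - lo) + lo) + Z           ≡⟨ solve 4 (λ κ d l Z → κ :* (d :+ l) :+ Z := κ :* d :+ (Z :+ κ :* l)) refl κ (hi - lo) lo Z ⟩
      κ * (hi - lo) + (Z + κ * lo)       ∎)
    where
    open ≤-Reasoning
    open Sort decTotalOrder using (sort; sort-↭; sort-↗)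
    n = length zs
    ws = sort (y ∷ zs)
    within′ : All (λ z → lo ≤ z × z ≤ hi) ws
    within′ = All-resp-↭ (↭-sym (sort-↭ (y ∷ zs))) within
    lo≤ : κ * lo ≤ κ * hi + Z
    lo≤ = subst (_≤ κ * hi + Z) (+-identityʳ _)
      (+-mono-≤ (*-monoˡ κ≥0 (≤-trans lo≤y y≤hi)) Z≥0)

  elements-bounded : ∀ {k} x (xs : Vec ℝ k) → let a = Vec.foldr′ _⊓_ x xs ; b = Vec.foldr′ _⊔_ x xs in
    (a ≤ x × x ≤ b) × All (λ y → a ≤ y × y ≤ b) (toList xs)
  elements-bounded x []       = (≤-refl , ≤-refl) , []
  elements-bounded x (y ∷ xs) with elements-bounded x xs
  ... | (a≤x , x≤b) , within =
    (≤-trans (x⊓y≤y y _) a≤x , ≤-trans x≤b (x≤y⊔x y _)) ,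
    (x⊓y≤x y _ , x≤x⊔y y _) ∷ All.map (λ (a≤ , ≤b) → ≤-trans (x⊓y≤y y _) a≤ , ≤-trans ≤b (x≤y⊔x y _)) within

-- Gap sizes, cells with their gaps, and the splitting of a gap.

gapSize : ℕ → ℕ
gapSize zero    = 0
gapSize (suc j) = gapSize j ℕ.+ suc (gapSize j)

1+gapSize≡2^ : ∀ j → suc (gapSize j) ≡ 2 ℕ.^ j
1+gapSize≡2^ zero    = refl
1+gapSize≡2^ (suc j) rewrite sym (1+gapSize≡2^ j) = eq (gapSize j)
  where
  eq : ∀ g → suc (g ℕ.+ suc g) ≡ 2 ℕ.* suc g
  eq = solve-∀

gapSize≤2^ : ∀ j → gapSize j ℕ.≤ 2 ℕ.^ j
gapSize≤2^ j = ℕ.≤-trans (ℕ.n≤1+n _) (ℕ.≤-reflexive (1+gapSize≡2^ j))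

replicate-++ : ∀ {A : Set} m n {x : A} → replicate m x ++ replicate n x ≡ replicate (m ℕ.+ n) x
replicate-++ zero    n = refl
replicate-++ (suc m) n = cong (_ ∷_) (replicate-++ m n)

data Side : Set where
  before after : Side

module Cells (R : RealNumbers) where
  open OrderedField R

  -- An element together with the 2 ^ l ∸ 1 free cells kept directly in front of it
  -- and the 2 ^ r ∸ 1 free cells kept directly behind it.
  record Cell : Set where
    constructor cell
    field
      lgap : ℕ
      elt  : ℝ
      rgap : ℕ
  open Cell public

  gap : Side → Cell → ℕ
  gap before = lgap
  gap after  = rgap

  elts : List Cell → List ℝ
  elts = map elt

  -- The recursion exposes the middle cell, which is the one that a split fills.
  free : ℕ → List (Maybe ℝ)
  free zero    = []
  free (suc j) = free j ++ nothing ∷ free j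

  block : Cell → List (Maybe ℝ)
  block (cell l x r) = free l ++ just x ∷ free r

  contents : List Cell → List (Maybe ℝ)
  contents = concatMap block

  length-free : ∀ j → length (free j) ≡ gapSize j
  length-free zero    = refl
  length-free (suc j) = trans (List.length-++ (free j)) (cong₂ ℕ._+_ (length-free j) (cong suc (length-free j)))

  free≡replicate : ∀ j → free j ≡ replicate (gapSize j) nothing
  free≡replicate zero    = refl
  free≡replicate (suc j) rewrite free≡replicate j = replicate-++ (gapSize j) (suc (gapSize j))

  catMaybes-free : ∀ j → catMaybes (free j) ≡ []
  catMaybes-free zero    = refl
  catMaybes-free (suc j) = trans (List.catMaybes-++ (free j) (nothing ∷ free j))
    (cong₂ _++_ (catMaybes-free j) (catMaybes-free j))

  catMaybes-contents : ∀ cs → catMaybes (contents cs) ≡ elts cs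
  catMaybes-contents []                = refl
  catMaybes-contents (cell l x r ∷ cs) = begin
    catMaybes ((free l ++ just x ∷ free r) ++ contents cs)        ≡⟨ List.catMaybes-++ (block (cell l x r)) (contents cs) ⟩
    catMaybes (free l ++ just x ∷ free r) ++ catMaybes (contents cs) ≡⟨ cong₂ _++_ (List.catMaybes-++ (free l) (just x ∷ free r)) (catMaybes-contents cs) ⟩
    (catMaybes (free l) ++ x ∷ catMaybes (free r)) ++ elts cs     ≡⟨ cong₂ (λ u v → (u ++ x ∷ v) ++ elts cs) (catMaybes-free l) (catMaybes-free r) ⟩
    x ∷ elts cs                                                   ∎
    where open ≡-Reasoning

  total : (ℕ → ℕ) → List Cell → ℕ
  total f = sum ∘ map (λ c → f (lgap c) ℕ.+ f (rgap c))

  waste weight : List Cell → ℕ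
  waste  = total gapSize
  weight = total (λ j → j ℕ.* 2 ℕ.^ j)

  total-++ : ∀ f cs ds → total f (cs ++ ds) ≡ total f cs ℕ.+ total f ds
  total-++ f cs ds = trans (cong sum (List.map-++ _ cs ds)) (sum-++ (map _ cs) (map _ ds))

  length-contents : ∀ cs → length (contents cs) ≡ length cs ℕ.+ waste cs
  length-contents []                = refl
  length-contents (cell l x r ∷ cs) = begin
    length (block (cell l x r) ++ contents cs)                     ≡⟨ List.length-++ (block (cell l x r)) ⟩
    length (free l ++ just x ∷ free r) ℕ.+ length (contents cs)    ≡⟨ cong₂ ℕ._+_ (List.length-++ (free l)) (length-contents cs) ⟩
    (length (free l) ℕ.+ suc (length (free r))) ℕ.+ (length cs ℕ.+ waste cs)
      ≡⟨ cong₂ (λ u v → (u ℕ.+ suc v) ℕ.+ (length cs ℕ.+ waste cs)) (length-free l) (length-free r) ⟩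
    (gapSize l ℕ.+ suc (gapSize r)) ℕ.+ (length cs ℕ.+ waste cs)   ≡⟨ eq (gapSize l) (gapSize r) (length cs) (waste cs) ⟩
    suc (length cs) ℕ.+ ((gapSize l ℕ.+ gapSize r) ℕ.+ waste cs)   ∎
    where
    open ≡-Reasoning
    eq : ∀ a b c d → (a ℕ.+ suc b) ℕ.+ (c ℕ.+ d) ≡ suc c ℕ.+ ((a ℕ.+ b) ℕ.+ d)
    eq = solve-∀

  -- The index `j` is the level of the two halves, one below that of the split gap. Both halves go
  -- to `y`, and `x` is left with level 0 on that side.
  data Split (y x : ℝ) (j : ℕ) : List Cell → List Cell → Set where
    inFront : ∀ {r cs} → Split y x j (cell (suc j) x r ∷ cs) (cell j y j ∷ cell 0 x r ∷ cs)
    behind  : ∀ {l cs} → Split y x j (cell l x (suc j) ∷ cs) (cell l x 0 ∷ cell j y j ∷ cs)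
    there   : ∀ {c cs cs′} → Split y x j cs cs′ → Split y x j (c ∷ cs) (c ∷ cs′)

  Split-++ : ∀ {y x j cs cs′} ds → Split y x j cs cs′ → Split y x j (ds ++ cs) (ds ++ cs′)
  Split-++ []       s = s
  Split-++ (d ∷ ds) s = there (Split-++ ds s)

  Split-length : ∀ {y x j cs cs′} → Split y x j cs cs′ → length cs′ ≡ suc (length cs)
  Split-length inFront   = refl
  Split-length behind    = refl
  Split-length (there s) = cong suc (Split-length s)

  -- Stated with sums on both sides to avoid subtraction; `f 0 ≡ 0` accounts for the side on which
  -- `x` loses its gap.
  Split-total : ∀ f → f 0 ≡ 0 → ∀ {y x j cs cs′} → Split y x j cs cs′ →
    total f cs ℕ.+ (f j ℕ.+ f j) ≡ total f cs′ ℕ.+ f (suc j)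
  Split-total f f0 {j = j} (inFront {r} {cs}) rewrite f0 = eq (f (suc j)) (f r) (total f cs) (f j)
    where
    eq : ∀ a b c d → (a ℕ.+ b) ℕ.+ c ℕ.+ (d ℕ.+ d) ≡ (d ℕ.+ d) ℕ.+ (b ℕ.+ c) ℕ.+ a
    eq = solve-∀
  Split-total f f0 {j = j} (behind {l} {cs}) rewrite f0 = eq (f (suc j)) (f l) (total f cs) (f j)
    where
    eq : ∀ a b c d → (b ℕ.+ a) ℕ.+ c ℕ.+ (d ℕ.+ d) ≡ (b ℕ.+ 0) ℕ.+ ((d ℕ.+ d) ℕ.+ c) ℕ.+ a
    eq = solve-∀
  Split-total f f0 {j = j} (there {c} {cs} {cs′} s) = begin
    k ℕ.+ total f cs ℕ.+ (f j ℕ.+ f j)    ≡⟨ ℕ.+-assoc k _ _ ⟩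
    k ℕ.+ (total f cs ℕ.+ (f j ℕ.+ f j))  ≡⟨ cong (k ℕ.+_) (Split-total f f0 s) ⟩
    k ℕ.+ (total f cs′ ℕ.+ f (suc j))     ≡⟨ sym (ℕ.+-assoc k _ _) ⟩
    k ℕ.+ total f cs′ ℕ.+ f (suc j)       ∎
    where
    open ≡-Reasoning
    k = f (lgap c) ℕ.+ f (rgap c)

  Split-waste : ∀ {y x j cs cs′} → Split y x j cs cs′ → waste cs ≡ suc (waste cs′)
  Split-waste {j = j} {cs} {cs′} s = ℕ.+-cancelʳ-≡ (gapSize j ℕ.+ gapSize j) _ _
    (trans (Split-total gapSize refl s) (eq (waste cs′) (gapSize j)))
    where
    eq : ∀ w g → w ℕ.+ (g ℕ.+ suc g) ≡ suc w ℕ.+ (g ℕ.+ g)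
    eq = solve-∀

  -- Since `(j + 1) * 2 ^ (j + 1) - 2 * j * 2 ^ j = 2 ^ (j + 1)`, the potential drops in proportion
  -- to the threshold at the level of the split gap.
  Split-weight : ∀ {y x j cs cs′} → Split y x j cs cs′ → weight cs ≡ 2 ℕ.^ suc j ℕ.+ weight cs′
  Split-weight {j = j} {cs} {cs′} s = ℕ.+-cancelʳ-≡ (p ℕ.+ p) _ _
    (trans (Split-total (λ i → i ℕ.* 2 ℕ.^ i) refl s) (eq (weight cs′) j (2 ℕ.^ j)))
    where
    p = j ℕ.* 2 ℕ.^ j
    eq : ∀ w j q → w ℕ.+ suc j ℕ.* (2 ℕ.* q) ≡ 2 ℕ.* q ℕ.+ w ℕ.+ (j ℕ.* q ℕ.+ j ℕ.* q)
    eq = solve-∀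

  Split-All : ∀ {Q : Cell → Set} {y x j cs cs′} → Split y x j cs cs′ →
    (∀ {l z r} → Q (cell l z r) → Q (cell 0 z r)) → (∀ {l z r} → Q (cell l z r) → Q (cell l z 0)) →
    Q (cell j y j) → All Q cs → All Q cs′
  Split-All inFront   f g q (p ∷ ps) = q ∷ f p ∷ ps
  Split-All behind    f g q (p ∷ ps) = g p ∷ q ∷ ps
  Split-All (there s) f g q (p ∷ ps) = p ∷ Split-All s f g q ps

  -- Effect of a split on the cost and on the array.

  detour : ∀ {x y} zs → variation (x ∷ y ∷ zs) ≤ variation (x ∷ zs) + (∣ y - x ∣ + ∣ y - x ∣)
  detour {x} {y} [] = subst₂ _≤_ (cong (_+ 0#) (∣x-y∣≡∣y-x∣ y x)) (sym (+-identityˡ _))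
    (+-monoʳ-≤ ∣ y - x ∣ (0≤∣x-y∣ y x))
  detour {x} {y} (z ∷ zs) = subst (λ d → d + (∣ y - z ∣ + v) ≤ ∣ x - z ∣ + v + (∣ y - x ∣ + ∣ y - x ∣)) (∣x-y∣≡∣y-x∣ y x)
    (≤-trans (+-monoʳ-≤ _ (+-monoˡ-≤ v (triangle y x z)))
      (≤-reflexive (solve 3 (λ d e v → d :+ ((d :+ e) :+ v) := (e :+ v) :+ (d :+ d)) refl _ _ _)))
    where v = variation (z ∷ zs)

  -- The preceding element `a` makes the induction work: a cell passed by `there` becomes the
  -- predecessor of the rest.
  Split-variation-∷ : ∀ {y x j cs cs′} → Split y x j cs cs′ → ∀ a →
    variation (a ∷ elts cs′) ≤ variation (a ∷ elts cs) + (∣ y - x ∣ + ∣ y - x ∣)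
  Split-variation-∷ {y} {x} (inFront {cs = cs}) a = begin
    ∣ a - y ∣ + (d + v)                ≤⟨ +-monoˡ-≤ (d + v) (triangle a x y) ⟩
    ∣ a - x ∣ + ∣ x - y ∣ + (d + v)    ≡⟨ cong (λ e → ∣ a - x ∣ + e + (d + v)) (∣x-y∣≡∣y-x∣ x y) ⟩
    ∣ a - x ∣ + d + (d + v)            ≡⟨ solve 3 (λ a d v → (a :+ d) :+ (d :+ v) := (a :+ v) :+ (d :+ d)) refl _ d v ⟩
    ∣ a - x ∣ + v + (d + d)            ∎
    where
    open ≤-Reasoning
    d = ∣ y - x ∣
    v = variation (x ∷ elts cs)
  Split-variation-∷ (behind {cs = cs}) a = ≤-trans (+-monoʳ-≤ _ (detour (elts cs))) (≤-reflexive (sym (+-assoc _ _ _)))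
  Split-variation-∷ (there {c} s) a =
    ≤-trans (+-monoʳ-≤ _ (Split-variation-∷ s (elt c))) (≤-reflexive (sym (+-assoc _ _ _)))

  Split-variation : ∀ {y x j cs cs′} → Split y x j cs cs′ →
    variation (elts cs′) ≤ variation (elts cs) + (∣ y - x ∣ + ∣ y - x ∣)
  Split-variation {y} {x} (inFront {cs = cs}) = ≤-trans (≤-reflexive (+-comm _ _))
    (+-monoʳ-≤ _ (subst (_≤ ∣ y - x ∣ + ∣ y - x ∣) (+-identityʳ _) (+-monoʳ-≤ _ (0≤∣x-y∣ y x))))
  Split-variation (behind {cs = cs})  = detour (elts cs)
  Split-variation (there {c} s)       = Split-variation-∷ s (elt c)

  -- One insertion as seen in the array: a single empty cell receives `y` and nothing moves.
  Fill : ℝ → List (Maybe ℝ) → List (Maybe ℝ) → Set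
  Fill y as bs = ∃₂ λ P Q → as ≡ P ++ nothing ∷ Q × bs ≡ P ++ just y ∷ Q

  Fill-++ˡ : ∀ {y as bs} cs → Fill y as bs → Fill y (cs ++ as) (cs ++ bs)
  Fill-++ˡ cs (P , Q , refl , refl) = cs ++ P , Q , sym (List.++-assoc cs P _) , sym (List.++-assoc cs P _)

  Fill-++ʳ : ∀ {y as bs} cs → Fill y as bs → Fill y (as ++ cs) (bs ++ cs)
  Fill-++ʳ cs (P , Q , refl , refl) = P , Q ++ cs , List.++-assoc P _ cs , List.++-assoc P _ cs

  Fill-free : ∀ y j → Fill y (free (suc j)) (block (cell j y j))
  Fill-free y j = free j , free j , refl , refl

  Split-contents : ∀ {y x j cs cs′} → Split y x j cs cs′ → Fill y (contents cs) (contents cs′)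
  Split-contents {y} {x} {j} (inFront {r} {cs}) =
    subst₂ (Fill y) (sym (List.++-assoc (free (suc j)) (just x ∷ free r) (contents cs))) refl
      (Fill-++ʳ (just x ∷ free r ++ contents cs) (Fill-free y j))
  Split-contents {y} {x} {j} (behind {l} {cs}) =
    subst₂ (Fill y) (sym (List.++-assoc (free l) (just x ∷ free (suc j)) (contents cs)))
      (sym (List.++-assoc (free l) [ just x ] (block (cell j y j) ++ contents cs)))
      (Fill-++ˡ (free l) (Fill-++ˡ [ just x ] (Fill-++ʳ (contents cs) (Fill-free y j))))
  Split-contents (there {c} s) = Fill-++ˡ (block c) (Split-contents s)

-- Thresholds, separation of gap owners, and the bound on free cells.

sum-filter : ∀ {A : Set} {P : A → Set} (f : A → ℕ) (P? : ∀ x → Dec (P x)) xs →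
  sum (map f xs) ≡ sum (map f (filter P? xs)) ℕ.+ sum (map f (filter (¬? ∘ P?) xs))
sum-filter f P? []       = refl
sum-filter f P? (x ∷ xs) with does (P? x)
... | true  = trans (cong (f x ℕ.+_) (sum-filter f P? xs)) (sym (ℕ.+-assoc (f x) _ _))
... | false = trans (cong (f x ℕ.+_) (sum-filter f P? xs)) (eq (f x) (sum (map f (filter P? xs))) _)
  where
  eq : ∀ a b c → a ℕ.+ (b ℕ.+ c) ≡ b ℕ.+ (a ℕ.+ c)
  eq = solve-∀

module Crowding (R : RealNumbers) (C : ℕ) (κ : ℕ) (D : OnlineSorting.ℝ R) where
  open OrderedField R
  open Cells R

  -- Distance at most `C * 2 ^ i * D / κ`, with the division cleared.
  Near : ℕ → ℝ → ℝ → Set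
  Near i y x = fromℕ κ * ∣ y - x ∣ ≤ fromℕ (C ℕ.* 2 ℕ.^ i) * D

  near? : ∀ i y x → Dec (Near i y x)
  near? i y x = _ ≤? _

  Near-sym : ∀ {i x y} → Near i x y → Near i y x
  Near-sym {i} {x} {y} = subst (λ d → fromℕ κ * d ≤ fromℕ (C ℕ.* 2 ℕ.^ i) * D) (∣x-y∣≡∣y-x∣ x y)

  -- On a fixed side every cell owns a single gap, so the owners of equal gaps are separate points
  -- to which packing applies. Level 0 is an empty gap and imposes nothing.
  Apart : Side → Cell → Cell → Set
  Apart s c c′ = ∀ i → gap s c ≡ suc i → gap s c′ ≡ suc i → ¬ Near (suc i) (elt c) (elt c′)

  FarFrom : ℝ → ℕ → Cell → Set
  FarFrom y i c = ∀ s → gap s c ≡ i → ¬ Near i y (elt c)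

  splitAt : ∀ j y cs → (∃₂ λ x cs′ → Near (suc j) y x × Split y x j cs cs′) ⊎ All (FarFrom y (suc j)) cs
  splitAt j y [] = inj₂ []
  splitAt j y (cell l x r ∷ cs) with near? (suc j) y x | l ℕ.≟ suc j | r ℕ.≟ suc j | splitAt j y cs
  ... | yes near | yes refl | _        | _ = inj₁ (x , _ , near , inFront)
  ... | yes near | no l≢    | yes refl | _ = inj₁ (x , _ , near , behind)
  ... | _        | _        | _        | inj₁ (z , cs′ , near , s) = inj₁ (z , _ , near , there s)
  ... | no ¬near | _        | _        | inj₂ far = inj₂ ((λ _ _ → ¬near) ∷ far)
  ... | yes near | no l≢    | no r≢    | inj₂ far =
    inj₂ ((λ { before l≡ → contradiction l≡ l≢ ; after r≡ → contradiction r≡ r≢ }) ∷ far)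

  -- Of the failures at lower levels only the one at `j` is recorded: the new gaps have level `j`,
  -- so it is the owners at this level that `y` must be far from. For `j = 0` both halves are empty.
  LowestSplit : ℝ → List Cell → Set
  LowestSplit y cs = ∃ λ j → ∃₂ λ x cs′ → Near (suc j) y x × Split y x j cs cs′ ×
    (∀ i → j ≡ suc i → All (FarFrom y j) cs)

  search : ∀ n y cs → LowestSplit y cs ⊎ (∀ i → i ℕ.< n → All (FarFrom y (suc i)) cs)
  search zero    y cs = inj₂ λ _ ()
  search (suc n) y cs with search n y cs
  ... | inj₁ found = inj₁ found
  ... | inj₂ far with splitAt n y cs
  ...   | inj₁ (x , cs′ , near , s) = inj₁ (n , x , cs′ , near , s , λ { i refl → far i (ℕ.n<1+n i) })
  ...   | inj₂ far-n = inj₂ all-far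
    where
    all-far : ∀ i → i ℕ.< suc n → All (FarFrom y (suc i)) cs
    all-far i i<1+n with ℕ.m≤n⇒m<n∨m≡n i<1+n
    ... | inj₁ 1+i<1+n = far i (ℕ.s<s⁻¹ 1+i<1+n)
    ... | inj₂ refl    = far-n

  Apart-lgap : ∀ s {c l x r} → Apart s c (cell l x r) → Apart s c (cell 0 x r)
  Apart-lgap before apart _ _ ()
  Apart-lgap after  apart = apart

  Apart-rgap : ∀ s {c l x r} → Apart s c (cell l x r) → Apart s c (cell l x 0)
  Apart-rgap before apart = apart
  Apart-rgap after  apart _ _ ()

  Apart-sym : ∀ s {c c′} → Apart s c c′ → Apart s c′ c
  Apart-sym s {c} {c′} apart i p q near = apart i q p (Near-sym {suc i} near)

  FarFrom⇒Apart : ∀ s {j y c} → (∀ i → j ≡ suc i → FarFrom y j c) → Apart s (cell j y j) c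
  FarFrom⇒Apart before far i refl q = far i refl before q
  FarFrom⇒Apart after  far i refl q = far i refl after q

  private
    new-Apart : ∀ s {j y cs} → (∀ i → j ≡ suc i → All (FarFrom y j) cs) → All (Apart s (cell j y j)) cs
    new-Apart s {cs = []} far = []
    new-Apart s {cs = c ∷ cs} far =
      FarFrom⇒Apart s (λ i eq → All.head (far i eq)) ∷ new-Apart s (λ i eq → All.tail (far i eq))

  -- The old owner only loses a gap, which removes constraints. The new gaps have level `j`, and by
  -- the choice of the lowest level `y` is far from all owners there.
  Split-AllPairs : ∀ s {y x j cs cs′} → Split y x j cs cs′ →
    (∀ i → j ≡ suc i → All (FarFrom y j) cs) → AllPairs (Apart s) cs → AllPairs (Apart s) cs′
  Split-AllPairs s (inFront {r} {cs}) far (p ∷ ps) with new-Apart s far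
  ... | q ∷ qs = (Apart-lgap s q ∷ qs) ∷ All.map (λ a → Apart-sym s (Apart-lgap s (Apart-sym s a))) p ∷ ps
  Split-AllPairs s (behind {l} {cs}) far (p ∷ ps) with new-Apart s far
  ... | q ∷ qs = (Apart-sym s (Apart-rgap s q) ∷ All.map (λ a → Apart-sym s (Apart-rgap s (Apart-sym s a))) p) ∷ qs ∷ ps
  Split-AllPairs s (there {c} {cs} split) far (p ∷ ps) =
    Split-All split (Apart-lgap s) (Apart-rgap s)
      (Apart-sym s (FarFrom⇒Apart s λ i eq → All.head (far i eq))) p
    ∷ Split-AllPairs s split (λ i eq → All.tail (far i eq)) ps

  sideTotal : Side → List Cell → ℕ
  sideTotal s = sum ∘ map (gapSize ∘ gap s)

  waste≡sideTotals : ∀ cs → waste cs ≡ sideTotal before cs ℕ.+ sideTotal after cs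
  waste≡sideTotals []       = refl
  waste≡sideTotals (c ∷ cs) = trans (cong ((gapSize (lgap c) ℕ.+ gapSize (rgap c)) ℕ.+_) (waste≡sideTotals cs))
    (eq (gapSize (lgap c)) (gapSize (rgap c)) (sideTotal before cs) (sideTotal after cs))
    where
    eq : ∀ a b c d → (a ℕ.+ b) ℕ.+ (c ℕ.+ d) ≡ (a ℕ.+ c) ℕ.+ (b ℕ.+ d)
    eq = solve-∀

  module _ {lo hi : ℝ} (y : ℝ) (lo≤y : lo ≤ y) (y≤hi : y ≤ hi) (D≥0 : 0# ≤ D) (hi-lo≤2D : hi - lo ≤ fromℕ 2 * D) where

    Within : Cell → Set
    Within c = lo ≤ elt c × elt c ≤ hi

    κ[hi-lo]≤2κD : fromℕ κ * (hi - lo) ≤ fromℕ (2 ℕ.* κ) * D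
    κ[hi-lo]≤2κD = begin
      fromℕ κ * (hi - lo)        ≤⟨ *-monoˡ (fromℕ≥0 κ) hi-lo≤2D ⟩
      fromℕ κ * (fromℕ 2 * D)    ≡⟨ solve 3 (λ k t d → k :* (t :* d) := (t :* k) :* d) refl (fromℕ κ) (fromℕ 2) D ⟩
      fromℕ 2 * fromℕ κ * D      ≡⟨ cong (_* D) (sym (fromℕ-* 2 κ)) ⟩
      fromℕ (2 ℕ.* κ) * D        ∎
      where open ≤-Reasoning

    -- When D = 0 all elements within the range coincide with y, so every one of them is near y.
    ¬Near⇒D≰0 : ∀ {i c} → Within c → ¬ Near i y (elt c) → ¬ D ≤ 0#
    ¬Near⇒D≰0 {i} {c} (lo≤c , c≤hi) ¬near D≤0 = ¬near (begin
      fromℕ κ * ∣ y - elt c ∣            ≤⟨ *-monoˡ (fromℕ≥0 κ) (∣x-y∣≤hi-lo lo≤y y≤hi lo≤c c≤hi) ⟩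
      fromℕ κ * (hi - lo)                ≤⟨ κ[hi-lo]≤2κD ⟩
      fromℕ (2 ℕ.* κ) * D                ≤⟨ *-monoˡ (fromℕ≥0 (2 ℕ.* κ)) D≤0 ⟩
      fromℕ (2 ℕ.* κ) * 0#               ≡⟨ trans (zeroʳ _) (sym (zeroʳ _)) ⟩
      fromℕ (C ℕ.* 2 ℕ.^ i) * 0#         ≤⟨ *-monoˡ (fromℕ≥0 (C ℕ.* 2 ℕ.^ i)) D≥0 ⟩
      fromℕ (C ℕ.* 2 ℕ.^ i) * D          ∎)
      where open ≤-Reasoning

    -- The owners together with `y` are spread by `C * 2 ^ (i + 1) * D / κ` inside a range of at
    -- most `2 * D`, so packing bounds their number. An owner that is not near `y` forces `D` to be
    -- positive, hence `D` cancels.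
    level-count : ∀ s i cs → All (λ c → gap s c ≡ suc i) cs → AllPairs (Apart s) cs →
      All (FarFrom y (suc i)) cs → All Within cs → length cs ℕ.* (C ℕ.* 2 ℕ.^ suc i) ℕ.≤ 2 ℕ.* κ
    level-count s i [] _ _ _ _ = ℕ.z≤n
    level-count s i cs@(c ∷ _) at@(eq ∷ _) apart far@(f ∷ _) within@(w ∷ _) =
      fromℕ-*-cancel (¬Near⇒D≰0 {suc i} {c} w (f s eq)) (begin
        fromℕ (length cs ℕ.* z) * D            ≡⟨ cong (_* D) (fromℕ-* (length cs) z) ⟩
        fromℕ (length cs) * fromℕ z * D        ≡⟨ *-assoc _ _ _ ⟩
        fromℕ (length cs) * (fromℕ z * D)      ≡⟨ cong (λ k → fromℕ k * (fromℕ z * D)) (sym (List.length-map elt cs)) ⟩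
        fromℕ (length (elts cs)) * (fromℕ z * D) ≤⟨ packing y (elts cs) (fromℕ≥0 κ) (*-nonNeg (fromℕ≥0 z) D≥0)
                                                   (All.map⁺ (far⇒spread at far) ∷ AllPairs.map⁺ (apart⇒spread at apart))
                                                   ((lo≤y , y≤hi) ∷ All.map⁺ within) ⟩
        fromℕ κ * (hi - lo)                    ≤⟨ κ[hi-lo]≤2κD ⟩
        fromℕ (2 ℕ.* κ) * D                    ∎)
      where
      open ≤-Reasoning
      z = C ℕ.* 2 ℕ.^ suc i
      far⇒spread : ∀ {cs} → All (λ c → gap s c ≡ suc i) cs → All (FarFrom y (suc i)) cs →
        All (λ c → Spread (fromℕ κ) (fromℕ z * D) y (elt c)) cs
      far⇒spread at far = All.zipWith (λ (eq , f) → ≰⇒≥ (f s eq)) (at , far)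
      apart⇒spread : ∀ {cs} → All (λ c → gap s c ≡ suc i) cs → AllPairs (Apart s) cs →
        AllPairs (λ c c′ → Spread (fromℕ κ) (fromℕ z * D) (elt c) (elt c′)) cs
      apart⇒spread []        []       = []
      apart⇒spread (eq ∷ at) (p ∷ ps) =
        All.zipWith (λ (eq′ , a) → ≰⇒≥ (a i eq eq′)) (at , p) ∷ apart⇒spread at ps

    private
      level-total : ∀ s i cs → All (λ c → gap s c ≡ i) cs → C ℕ.* sideTotal s cs ℕ.≤ length cs ℕ.* (C ℕ.* 2 ℕ.^ i)
      level-total s i []       []        = ℕ.≤-reflexive (ℕ.*-zeroʳ C)
      level-total s i (c ∷ cs) (refl ∷ at) = ℕ.≤-trans (ℕ.≤-reflexive (ℕ.*-distribˡ-+ C (gapSize i) _))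
        (ℕ.+-mono-≤ (ℕ.*-monoʳ-≤ C (gapSize≤2^ i)) (level-total s i cs at))

      level-zero : ∀ s cs → All (λ c → gap s c ℕ.≤ 0) cs → sideTotal s cs ≡ 0
      level-zero s []       []       = refl
      level-zero s (c ∷ cs) (le ∷ ps) rewrite ℕ.n≤0⇒n≡0 le = level-zero s cs ps

    -- The highest level is peeled off first. Gap size doubles with the level while the permitted
    -- number of owners halves, so every level contributes at most `2 * κ / C` free cells.
    side-bound : ∀ s n cs → All (λ c → gap s c ℕ.≤ n) cs → AllPairs (Apart s) cs →
      (∀ i → i ℕ.< n → All (FarFrom y (suc i)) cs) → All Within cs →
      C ℕ.* sideTotal s cs ℕ.≤ n ℕ.* (2 ℕ.* κ)
    side-bound s zero    cs small _ _ _ = ℕ.≤-reflexive (trans (cong (C ℕ.*_) (level-zero s cs small)) (ℕ.*-zeroʳ C))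
    side-bound s (suc n) cs small apart far within = begin
      C ℕ.* sideTotal s cs                                ≡⟨ cong (C ℕ.*_) (sum-filter (gapSize ∘ gap s) top? cs) ⟩
      C ℕ.* (sideTotal s top ℕ.+ sideTotal s rest)        ≡⟨ ℕ.*-distribˡ-+ C (sideTotal s top) _ ⟩
      C ℕ.* sideTotal s top ℕ.+ C ℕ.* sideTotal s rest    ≤⟨ ℕ.+-mono-≤
          (ℕ.≤-trans (level-total s (suc n) top (All.all-filter top? cs))
            (level-count s n top (All.all-filter top? cs) (AllPairs.filter⁺ top? apart)
              (All.filter⁺ top? (far n (ℕ.n<1+n n))) (All.filter⁺ top? within)))
          (side-bound s n rest
            (All.zipWith (λ (le , ≢) → ℕ.≤-pred (ℕ.≤∧≢⇒< le ≢)) (All.filter⁺ rest? small , All.all-filter rest? cs))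
            (AllPairs.filter⁺ rest? apart)
            (λ i i<n → All.filter⁺ rest? (far i (ℕ.m<n⇒m<1+n i<n))) (All.filter⁺ rest? within)) ⟩
      2 ℕ.* κ ℕ.+ n ℕ.* (2 ℕ.* κ)                         ∎
      where
      open ℕ.≤-Reasoning
      top? : ∀ c → Dec (gap s c ≡ suc n)
      top? c = gap s c ℕ.≟ suc n
      rest? : ∀ c → Dec (¬ gap s c ≡ suc n)
      rest? c = ¬? (top? c)
      top rest : List Cell
      top  = filter top? cs
      rest = filter rest? cs

    -- The factor 4 combines the two sides with the range `2 * D`.
    waste-bound : ∀ n cs → All (λ c → ∀ s → gap s c ℕ.≤ n) cs → (∀ s → AllPairs (Apart s) cs) →
      (∀ i → i ℕ.< n → All (FarFrom y (suc i)) cs) → All Within cs →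
      C ℕ.* waste cs ℕ.≤ 4 ℕ.* n ℕ.* κ
    waste-bound n cs small apart far within = begin
      C ℕ.* waste cs                                            ≡⟨ cong (C ℕ.*_) (waste≡sideTotals cs) ⟩
      C ℕ.* (sideTotal before cs ℕ.+ sideTotal after cs)        ≡⟨ ℕ.*-distribˡ-+ C (sideTotal before cs) _ ⟩
      C ℕ.* sideTotal before cs ℕ.+ C ℕ.* sideTotal after cs    ≤⟨ ℕ.+-mono-≤ (bound before) (bound after) ⟩
      n ℕ.* (2 ℕ.* κ) ℕ.+ n ℕ.* (2 ℕ.* κ)                       ≡⟨ eq n κ ⟩
      4 ℕ.* n ℕ.* κ                                             ∎
      where
      open ℕ.≤-Reasoning
      bound : ∀ s → C ℕ.* sideTotal s cs ℕ.≤ n ℕ.* (2 ℕ.* κ)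
      bound s = side-bound s n cs (All.map (λ le → le s) small) (apart s) far within
      eq : ∀ n κ → n ℕ.* (2 ℕ.* κ) ℕ.+ n ℕ.* (2 ℕ.* κ) ≡ 4 ℕ.* n ℕ.* κ
      eq = solve-∀

-- Powers of two and integer logarithms.

2^-cancel-< : ∀ {m n} → 2 ℕ.^ m ℕ.< 2 ℕ.^ n → m ℕ.< n
2^-cancel-< {m} {n} lt with m ℕ.<? n
... | yes m<n = m<n
... | no m≮n  = contradiction (ℕ.^-monoʳ-≤ 2 (ℕ.≮⇒≥ m≮n)) (ℕ.<⇒≱ lt)

2^-step : ∀ q → 2 ℕ.^ q ℕ.≤ 2 ℕ.^ suc q
2^-step q = ℕ.m≤m+n (2 ℕ.^ q) _

floorLog : ∀ m → ∃ λ k → 2 ℕ.^ k ℕ.≤ suc m × suc m ℕ.< 2 ℕ.^ suc k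
floorLog zero    = 0 , ℕ.≤-refl , ℕ.≤-refl
floorLog (suc m) with floorLog m
... | k , 2^k≤ , <2^ with suc (suc m) ℕ.<? 2 ℕ.^ suc k
...   | yes lt = k , ℕ.m≤n⇒m≤1+n 2^k≤ , lt
...   | no ≮   = suc k , ℕ.≮⇒≥ ≮ , ℕ.≤-<-trans <2^ (ℕ.^-monoʳ-< 2 ℕ.≤-refl (ℕ.n<1+n (suc k)))

-- A single doubling suffices because `t` grows by one at a time.
growExponent : ℕ → ℕ → ℕ
growExponent t q with t ℕ.≤? 2 ℕ.^ q
... | yes _ = q
... | no  _ = suc q

m<n*[1+m/n] : ∀ m n .{{_ : ℕ.NonZero n}} → m ℕ.< n ℕ.* suc (m ℕ./ n)
m<n*[1+m/n] m n = begin-strict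
  m                              ≡⟨ ℕ.m≡m%n+[m/n]*n m n ⟩
  m ℕ.% n ℕ.+ m ℕ./ n ℕ.* n      <⟨ ℕ.+-monoˡ-< (m ℕ./ n ℕ.* n) (ℕ.m%n<n m n) ⟩
  n ℕ.+ m ℕ./ n ℕ.* n            ≡⟨ ℕ.*-comm (suc (m ℕ./ n)) n ⟩
  n ℕ.* suc (m ℕ./ n)            ∎
  where open ℕ.≤-Reasoning

-- Amortised accounting of the cost.

module Accounting (R : RealNumbers) where
  open OrderedField R

  -- The amortisation inequality: the cost `V` plus the potential `p` is covered by the budget `u`,
  -- where `p` and `u` are counted in units of `D / κ`.
  record Paid (κ p u : ℕ) (V D : ℝ) : Set where
    constructor mkPaid
    field payment : fromℕ κ * V + fromℕ p * D ≤ fromℕ u * D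

  fromℕ-*-assoc : ∀ m n x → fromℕ (m ℕ.* n) * x ≡ fromℕ m * (fromℕ n * x)
  fromℕ-*-assoc m n x = trans (cong (_* x) (fromℕ-* m n)) (*-assoc _ _ _)

  fromℕ-+-* : ∀ m n x → fromℕ (m ℕ.+ n) * x ≡ fromℕ m * x + fromℕ n * x
  fromℕ-+-* m n x = trans (cong (_* x) (fromℕ-+ m n)) (distribʳ x _ _)

  *-cancel-fromℕ : ∀ {k x y} → 0 ℕ.< k → fromℕ k * x ≤ fromℕ k * y → x ≤ y
  *-cancel-fromℕ {suc k} {x} {y} _ le = subst₂ _≤_ (undo x) (undo y)
    (*-monoˡ (inv≥0 (fromℕ≥0 (suc k)) (fromℕ-suc≢0 k)) le)
    where
    a = fromℕ (suc k)
    undo : ∀ z → a ⁻¹ * (a * z) ≡ z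
    undo z = trans (sym (*-assoc _ a z)) (trans (cong (_* z) (trans (*-comm _ a) (*-inverseʳ a (fromℕ-suc≢0 k)))) (*-identityˡ z))

  -- A cost increase of at most `z` units is covered by the drop of the potential together with the
  -- rise of the budget.
  pay : ∀ κ {p u p′ u′ V V′ D d} z → 0# ≤ D → V′ ≤ V + d → fromℕ κ * d ≤ fromℕ z * D →
    Paid κ p u V D → z ℕ.+ p′ ℕ.+ u ℕ.≤ p ℕ.+ u′ → Paid κ p′ u′ V′ D
  pay κ {p} {u} {p′} {u′} {V} {V′} {D} {d} z D≥0 V′≤ κd≤ (mkPaid paid) le = mkPaid (+-cancelʳ-≤ (u# * D) (begin
    (κ# * V′ + p′# * D) + u# * D          ≤⟨ +-monoˡ-≤ _ (+-monoˡ-≤ _ (*-monoˡ (fromℕ≥0 κ) V′≤)) ⟩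
    (κ# * (V + d) + p′# * D) + u# * D     ≡⟨ solve 5 (λ k V d p u → (k :* (V :+ d) :+ p) :+ u := k :* V :+ (k :* d :+ p :+ u)) refl κ# V d (p′# * D) (u# * D) ⟩
    κ# * V + (κ# * d + p′# * D + u# * D)  ≤⟨ +-monoʳ-≤ _ (+-monoˡ-≤ _ (+-monoˡ-≤ _ κd≤)) ⟩
    κ# * V + (fromℕ z * D + p′# * D + u# * D) ≡⟨ cong (κ# * V +_) (sym (trans (fromℕ-+-* (z ℕ.+ p′) u D) (cong (_+ u# * D) (fromℕ-+-* z p′ D)))) ⟩
    κ# * V + fromℕ (z ℕ.+ p′ ℕ.+ u) * D   ≤⟨ +-monoʳ-≤ _ (fromℕ-*-mono D≥0 le) ⟩
    κ# * V + fromℕ (p ℕ.+ u′) * D         ≡⟨ cong (κ# * V +_) (fromℕ-+-* p u′ D) ⟩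
    κ# * V + (fromℕ p * D + u′# * D)      ≡⟨ sym (+-assoc _ _ _) ⟩
    (κ# * V + fromℕ p * D) + u′# * D      ≤⟨ +-monoˡ-≤ _ paid ⟩
    u# * D + u′# * D                      ≡⟨ +-comm _ _ ⟩
    u′# * D + u# * D                      ∎))
    where
    open ≤-Reasoning
    κ# = fromℕ κ
    p′# = fromℕ p′
    u# = fromℕ u
    u′# = fromℕ u′

  weaken : ∀ κ {p u p′ u′ V D} → 0# ≤ D → Paid κ p u V D → p′ ℕ.+ u ℕ.≤ p ℕ.+ u′ → Paid κ p′ u′ V D
  weaken κ D≥0 = pay κ 0 D≥0 (≤-reflexive (sym (+-identityʳ _))) (≤-reflexive (trans (zeroʳ _) (sym (zeroˡ _))))

  -- Doubling `κ` halves the unit, so both amounts double.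
  Paid-double : ∀ κ {p u V D} → Paid κ p u V D → Paid (2 ℕ.* κ) (2 ℕ.* p) (2 ℕ.* u) V D
  Paid-double κ {p} {u} {V} {D} (mkPaid paid) = mkPaid (subst₂ _≤_
    (trans (distribˡ _ _ _) (sym (cong₂ _+_ (fromℕ-*-assoc 2 κ V) (fromℕ-*-assoc 2 p D))))
    (sym (fromℕ-*-assoc 2 u D)) (*-monoˡ (fromℕ≥0 2) paid))

-- States of the scheme, its steps and the invariant.

module GapSplitting (R : RealNumbers) (N e C G : ℕ) where
  open OrderedField R
  open Cells R
  open Accounting R

  -- The threshold at level j is C * 2 ^ j * D / κ, with κ = 2 ^ exponent the length of cur
  -- rounded up to a power of two and 1 / E in the role of ε.  Between two restarts, G * D
  -- is the budget for one doubling of κ; Γ * D bounds the sum over all doublings.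
  E Γ : ℕ
  E = suc e
  Γ = G ℕ.* (N ℕ.+ 3)

  -- cur holds the elements that arrived since the last restart, and old the earlier ones,
  -- whose gaps are abandoned; scale is the range of all elements at the time of that restart.
  record State : Set where
    constructor state
    field
      old cur        : List Cell
      exponent       : ℕ
      low high scale : ℝ

    cells : List Cell
    cells = old ++ cur

  -- With scale `0#`, the first element different from `y` forces a restart; repetitions of `y`
  -- before it cost nothing.
  start : ℝ → State
  start y = state [] [ cell 0 y 0 ] 0 y y 0#

  -- The largest `j` with `2 ^ j ≤ 1 + t / (4 * E)`: two gaps of this level have at most
  -- `t / (2 * E)` cells, half of the allowance.
  freshLevel : ℕ → ℕ
  freshLevel t = proj₁ (floorLog (t ℕ./ (4 ℕ.* E)))

  -- Each constructor carries the facts that the invariant will need. In `refine` and `extend` the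
  -- exponent is updated for `y` before nearness is tested, so the thresholds are those of the new
  -- state.
  data Step (y : ℝ) : State → State → Set where
    refine : ∀ {old cur cur′ q lo hi D j x} → let q′ = growExponent (suc (length cur)) q in
      (hi ⊔ y) - (lo ⊓ y) ≤ fromℕ 2 * D →
      Crowding.Near R C (2 ℕ.^ q′) D (suc j) y x → Split y x j cur cur′ →
      (∀ i → j ≡ suc i → All (Crowding.FarFrom R C (2 ℕ.^ q′) D y j) cur) →
      Step y (state old cur q lo hi D) (state old cur′ q′ (lo ⊓ y) (hi ⊔ y) D)
    extend : ∀ {old cur q lo hi D} →
      let q′ = growExponent (suc (length cur)) q
          j  = freshLevel (suc (length cur)) in
      (hi ⊔ y) - (lo ⊓ y) ≤ fromℕ 2 * D →
      (∀ i → i ℕ.< N → All (Crowding.FarFrom R C (2 ℕ.^ q′) D y (suc i)) cur) →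
      Step y (state old cur q lo hi D) (state old (cur ∷ʳ cell j y j) q′ (lo ⊓ y) (hi ⊔ y) D)
    restart : ∀ {old cur q lo hi D} →
      fromℕ 2 * D ≤ (hi ⊔ y) - (lo ⊓ y) →
      Step y (state old cur q lo hi D)
             (state (old ++ cur) [ cell 0 y 0 ] 0 (lo ⊓ y) (hi ⊔ y) ((hi ⊔ y) - (lo ⊓ y)))

  step : ∀ y st → ∃ (Step y st)
  step y (state old cur q lo hi D) with ((hi ⊔ y) - (lo ⊓ y)) ≤? (fromℕ 2 * D)
  ... | no exceeds = _ , restart (≰⇒≥ exceeds)
  ... | yes fits with Crowding.search R C (2 ℕ.^ growExponent (suc (length cur)) q) D N y cur
  ...   | inj₁ (j , x , cur′ , near , split , far) = _ , refine fits near split far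
  ...   | inj₂ far = _ , extend fits far

  -- In units of `D / κ`: an amount `Γ * D` for the cost inherited at the restart, `G * D` for each
  -- of the `q` doublings, and `G` units for each of the `s` cells held by current elements and
  -- their gaps.
  budget : ℕ → ℕ → ℕ
  budget q s = 2 ℕ.^ q ℕ.* Γ ℕ.+ 2 ℕ.^ q ℕ.* G ℕ.* q ℕ.+ G ℕ.* s

  Inside : ℝ → ℝ → Cell → Set
  Inside lo hi c = lo ≤ elt c × elt c ≤ hi

  record Invariant (st : State) : Set where
    open State st
    field
      scale≥0  : 0# ≤ scale
      range    : high - low ≤ fromℕ 2 * scale
      inside   : All (Inside low high) cur
      t≤κ      : length cur ℕ.≤ 2 ℕ.^ exponent
      κ≤2t     : 2 ℕ.^ exponent ℕ.≤ 2 ℕ.* length cur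
      levels   : All (λ c → ∀ s → gap s c ℕ.≤ N) cur
      apart    : ∀ s → AllPairs (Crowding.Apart R C (2 ℕ.^ exponent) scale s) cur
      oldWaste : E ℕ.* waste old ℕ.≤ length old
      curWaste : E ℕ.* waste cur ℕ.≤ length cur
      paid     : Paid (2 ℕ.^ exponent) (2 ℕ.* C ℕ.* weight cur) (budget exponent (length cur ℕ.+ waste cur)) (variation (elts cells)) scale

    w≤t : waste cur ℕ.≤ length cur
    w≤t = ℕ.≤-trans (ℕ.m≤m+n _ _) curWaste

  -- A larger `κ` shrinks all thresholds, so separation survives a doubling.
  Apart-mono : ∀ {κ κ′ D} s {c c′} → κ ℕ.≤ κ′ → Crowding.Apart R C κ D s c c′ → Crowding.Apart R C κ′ D s c c′
  Apart-mono s {c} {c′} κ≤κ′ apart i p q near =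
    apart i p q (≤-trans (fromℕ-*-mono (0≤∣x-y∣ (elt c) (elt c′)) κ≤κ′) near)

  Inside-mono : ∀ {lo hi} y {cs} → All (Inside lo hi) cs → All (Inside (lo ⊓ y) (hi ⊔ y)) cs
  Inside-mono {lo} {hi} y = All.map λ (l , h) → ≤-trans (x⊓y≤x lo y) l , ≤-trans h (x≤x⊔y hi y)

  Inside-new : ∀ {lo hi} y → lo ⊓ y ≤ y × y ≤ hi ⊔ y
  Inside-new {lo} {hi} y = x⊓y≤y lo y , x≤y⊔x hi y

  record Grown (t w p q q′ : ℕ) (V D : ℝ) : Set where
    field
      1+t≤κ′ : suc t ℕ.≤ 2 ℕ.^ q′
      κ′≤    : 2 ℕ.^ q′ ℕ.≤ 2 ℕ.* suc t
      κ≤κ′   : 2 ℕ.^ q ℕ.≤ 2 ℕ.^ q′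
      paid′  : Paid (2 ℕ.^ q′) p (budget q′ (t ℕ.+ w)) V D

  -- Doubling happens only at `t = κ`. Rescaling then inflates the term `G * s` by another
  -- `G * s ≤ 2 * κ * G`, as `s = t + w ≤ 2 * κ`; this is what the term for one more doubling
  -- supplies.
  grow : ∀ {t w p q V D} → 0# ≤ D → t ℕ.≤ 2 ℕ.^ q → 2 ℕ.^ q ℕ.≤ 2 ℕ.* t → w ℕ.≤ t →
    Paid (2 ℕ.^ q) p (budget q (t ℕ.+ w)) V D → Grown t w p q (growExponent (suc t) q) V D
  grow {t} {w} {p} {q} D≥0 t≤κ κ≤2t w≤t paid with suc t ℕ.≤? 2 ℕ.^ q
  ... | yes 1+t≤κ = record
    { 1+t≤κ′ = 1+t≤κ
    ; κ′≤    = ℕ.≤-trans κ≤2t (ℕ.*-monoʳ-≤ 2 (ℕ.n≤1+n t))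
    ; κ≤κ′   = ℕ.≤-refl
    ; paid′  = paid }
  ... | no 1+t≰κ with ℕ.≤-antisym t≤κ (ℕ.≤-pred (ℕ.≰⇒> 1+t≰κ))
  ...   | t≡κ = record
    { 1+t≤κ′ = ℕ.≤-trans (ℕ.≤-reflexive (cong suc t≡κ)) (ℕ.^-monoʳ-< 2 ℕ.≤-refl (ℕ.n<1+n q))
    ; κ′≤    = ℕ.*-monoʳ-≤ 2 (ℕ.≤-trans (ℕ.≤-reflexive (sym t≡κ)) (ℕ.n≤1+n t))
    ; κ≤κ′   = 2^-step q
    ; paid′  = weaken (2 ℕ.^ suc q) D≥0 (Paid-double (2 ℕ.^ q) paid) enough }
    where
    open ℕ.≤-Reasoning
    κ = 2 ℕ.^ q
    s = t ℕ.+ w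
    lhs : ∀ p k Γ G q s → p ℕ.+ 2 ℕ.* (k ℕ.* Γ ℕ.+ k ℕ.* G ℕ.* q ℕ.+ G ℕ.* s) ≡
      (p ℕ.+ 2 ℕ.* (k ℕ.* Γ ℕ.+ k ℕ.* G ℕ.* q) ℕ.+ G ℕ.* s) ℕ.+ G ℕ.* s
    lhs = solve-∀
    rhs : ∀ p k Γ G q s → (p ℕ.+ 2 ℕ.* (k ℕ.* Γ ℕ.+ k ℕ.* G ℕ.* q) ℕ.+ G ℕ.* s) ℕ.+ G ℕ.* (k ℕ.+ k) ≡
      p ℕ.+ (2 ℕ.* k ℕ.* Γ ℕ.+ 2 ℕ.* k ℕ.* G ℕ.* suc q ℕ.+ G ℕ.* s)
    rhs = solve-∀
    enough : p ℕ.+ 2 ℕ.* budget q s ℕ.≤ 2 ℕ.* p ℕ.+ budget (suc q) s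
    enough = begin
      p ℕ.+ 2 ℕ.* budget q s    ≡⟨ lhs p κ Γ G q s ⟩
      (p ℕ.+ 2 ℕ.* (κ ℕ.* Γ ℕ.+ κ ℕ.* G ℕ.* q) ℕ.+ G ℕ.* s) ℕ.+ G ℕ.* s
        ≤⟨ ℕ.+-monoʳ-≤ (p ℕ.+ 2 ℕ.* (κ ℕ.* Γ ℕ.+ κ ℕ.* G ℕ.* q) ℕ.+ G ℕ.* s)
             (ℕ.*-monoʳ-≤ G (ℕ.+-mono-≤ t≤κ (ℕ.≤-trans w≤t t≤κ))) ⟩
      (p ℕ.+ 2 ℕ.* (κ ℕ.* Γ ℕ.+ κ ℕ.* G ℕ.* q) ℕ.+ G ℕ.* s) ℕ.+ G ℕ.* (κ ℕ.+ κ)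
        ≡⟨ rhs p κ Γ G q s ⟩
      p ℕ.+ budget (suc q) s    ≤⟨ ℕ.+-monoˡ-≤ _ (ℕ.m≤m+n p _) ⟩
      2 ℕ.* p ℕ.+ budget (suc q) s ∎

  Invariant-grow : ∀ {st} (I : Invariant st) → let open State st in
    Grown (length cur) (waste cur) (2 ℕ.* C ℕ.* weight cur) exponent (growExponent (suc (length cur)) exponent)
      (variation (elts cells)) scale
  Invariant-grow {st} I = grow {p = 2 ℕ.* C ℕ.* weight (State.cur st)} scale≥0 t≤κ κ≤2t w≤t paid
    where open Invariant I

-- Every step preserves the invariant.

module Preservation (R : RealNumbers) (N e C G n : ℕ) (C≡ : C ≡ 16 ℕ.* (suc e ℕ.* N)) (G≡ : G ≡ 2 ℕ.* C ℕ.* suc (2 ℕ.* N))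
                    (N≥1 : 1 ℕ.≤ N) (n<2^[1+N] : n ℕ.< 2 ℕ.^ suc N) where
  open OrderedField R
  open Cells R
  open Accounting R
  open GapSplitting R N e C G

  -- `κ ≤ 2 * t ≤ 2 * n < 2 ^ (N + 2)`, so there are only logarithmically many doublings.
  exponent≤1+N : ∀ {st} → Invariant st → length (State.cur st) ℕ.≤ n → State.exponent st ℕ.≤ suc N
  exponent≤1+N I t≤n = ℕ.≤-pred (2^-cancel-< (ℕ.≤-<-trans κ≤2t (ℕ.*-monoʳ-< 2 (ℕ.≤-<-trans t≤n n<2^[1+N]))))
    where open Invariant I

  -- After dropping the potential, the doublings take at most `κ * G * (N + 1)` and the cells at
  -- most `2 * κ * G` units. Together this is `κ * Γ`, which explains `N + 3` in `Γ`; the inherited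
  -- part is another `κ * Γ`.
  variation-bound : ∀ {st} → Invariant st → length (State.cur st) ℕ.≤ n →
    variation (elts (State.cells st)) ≤ fromℕ (2 ℕ.* Γ) * State.scale st
  variation-bound {st} I t≤n = *-cancel-fromℕ (ℕ.m^n>0 2 exponent) (begin
    fromℕ κ * V                                             ≡⟨ sym (+-identityʳ _) ⟩
    fromℕ κ * V + 0#                                        ≤⟨ +-monoʳ-≤ _ (*-nonNeg (fromℕ≥0 (2 ℕ.* C ℕ.* weight cur)) scale≥0) ⟩
    fromℕ κ * V + fromℕ (2 ℕ.* C ℕ.* weight cur) * scale    ≤⟨ Paid.payment paid ⟩
    fromℕ (budget exponent (length cur ℕ.+ waste cur)) * scale ≤⟨ fromℕ-*-mono scale≥0 budget≤ ⟩
    fromℕ (κ ℕ.* (2 ℕ.* Γ)) * scale                         ≡⟨ fromℕ-*-assoc κ (2 ℕ.* Γ) scale ⟩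
    fromℕ κ * (fromℕ (2 ℕ.* Γ) * scale)                     ∎)
    where
    open ≤-Reasoning
    open State st
    open Invariant I
    κ = 2 ℕ.^ exponent
    V = variation (elts cells)
    eq : ∀ κ G N → κ ℕ.* (G ℕ.* (N ℕ.+ 3)) ℕ.+ κ ℕ.* G ℕ.* suc N ℕ.+ G ℕ.* (κ ℕ.+ κ) ≡ κ ℕ.* (2 ℕ.* (G ℕ.* (N ℕ.+ 3)))
    eq = solve-∀
    budget≤ : budget exponent (length cur ℕ.+ waste cur) ℕ.≤ κ ℕ.* (2 ℕ.* Γ)
    budget≤ = ℕ.≤-trans
      (ℕ.+-mono-≤ (ℕ.+-monoʳ-≤ (κ ℕ.* Γ) (ℕ.*-monoʳ-≤ (κ ℕ.* G) (exponent≤1+N I t≤n)))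
                  (ℕ.*-monoʳ-≤ G (ℕ.+-mono-≤ t≤κ (ℕ.≤-trans w≤t t≤κ))))
      (ℕ.≤-reflexive (eq κ G N))

  G≥1 : 1 ℕ.≤ G
  G≥1 = subst (1 ℕ.≤_) (sym (trans G≡ (cong (λ c → 2 ℕ.* c ℕ.* suc (2 ℕ.* N)) C≡)))
    (ℕ.*-mono-≤ {1} (ℕ.*-mono-≤ {1} {2} (ℕ.s≤s ℕ.z≤n) (ℕ.*-mono-≤ {1} {16} (ℕ.s≤s ℕ.z≤n)
      (ℕ.*-mono-≤ {1} {E} (ℕ.s≤s ℕ.z≤n) N≥1))) (ℕ.s≤s (ℕ.z≤n {2 ℕ.* N})))

  Split-level : ∀ {y x j cs cs′} → Split y x j cs cs′ → All (λ c → ∀ s → gap s c ℕ.≤ N) cs → suc j ℕ.≤ N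
  Split-level inFront   (le ∷ _)   = le before
  Split-level behind    (le ∷ _)   = le after
  Split-level (there s) (_ ∷ les)  = Split-level s les

  -- Only the last jump is new, and it starts in `cur`, which is why `cur` must be nonempty.
  snoc-variation : ∀ {lo hi} old cur c → 1 ℕ.≤ length cur → All (Inside lo hi) cur → Inside lo hi c →
    variation (elts ((old ++ cur) ++ [ c ])) ≤ variation (elts (old ++ cur)) + (hi - lo)
  snoc-variation {lo} {hi} old cur c t≥1 inside (lo≤c , c≤hi) with initLast cur
  ... | cs ∷ʳ′ d with All.++⁻ʳ cs inside
  ...   | (lo≤d , d≤hi) ∷ [] = subst₂ (λ u v → variation u ≤ variation v + (hi - lo))
    (sym (trans (List.map-++ elt (old ++ cs ∷ʳ d) [ c ]) (cong (_++ [ elt c ]) elts-snoc))) (sym elts-snoc)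
    (variation-snoc (elts (old ++ cs)) (elt d) (elt c) (∣x-y∣≤hi-lo lo≤d d≤hi lo≤c c≤hi))
    where
    elts-snoc : elts (old ++ cs ∷ʳ d) ≡ elts (old ++ cs) ++ [ elt d ]
    elts-snoc = trans (cong elts (sym (List.++-assoc old cs [ d ]))) (List.map-++ elt (old ++ cs) [ d ])

  length≥1 : ∀ {st} → Invariant st → 1 ℕ.≤ length (State.cur st)
  length≥1 {state _ cur q _ _ _} I = positive (length cur) (ℕ.≤-trans (ℕ.m^n>0 2 q) (Invariant.κ≤2t I))
    where
    positive : ∀ t → 1 ℕ.≤ 2 ℕ.* t → 1 ℕ.≤ t
    positive (suc t) _ = ℕ.s≤s ℕ.z≤n

  module _ {old cur : List Cell} {q : ℕ} {lo hi D y : ℝ} (I : Invariant (state old cur q lo hi D)) where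
    open Invariant I
    open Grown (Invariant-grow I)
    private
      q′ κ′ : ℕ
      q′ = growExponent (suc (length cur)) q
      κ′ = 2 ℕ.^ q′

    -- A reserved free cell becomes occupied, so `t + w` and with it the budget stay the same. The
    -- detour costs at most twice the threshold, which the drop `2 * C * 2 ^ (j + 1)` of the
    -- potential matches.
    refine-preserves : ∀ {j x cur′} → (hi ⊔ y) - (lo ⊓ y) ≤ fromℕ 2 * D →
      Crowding.Near R C κ′ D (suc j) y x → Split y x j cur cur′ →
      (∀ i → j ≡ suc i → All (Crowding.FarFrom R C κ′ D y j) cur) →
      Invariant (state old cur′ q′ (lo ⊓ y) (hi ⊔ y) D)
    refine-preserves {j} {x} {cur′} fits near split far = record
      { scale≥0  = scale≥0
      ; range    = fits
      ; inside   = Split-All split (λ p → p) (λ p → p) (Inside-new {lo} {hi} y) (Inside-mono y inside)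
      ; t≤κ      = ℕ.≤-trans (ℕ.≤-reflexive len) 1+t≤κ′
      ; κ≤2t     = ℕ.≤-trans κ′≤ (ℕ.≤-reflexive (cong (2 ℕ.*_) (sym len)))
      ; levels   = Split-All split (λ le → λ { before → ℕ.z≤n ; after → le after })
                     (λ le → λ { before → le before ; after → ℕ.z≤n })
                     (λ { before → j≤N ; after → j≤N }) levels
      ; apart    = λ s → Crowding.Split-AllPairs R C κ′ D s split far
                     (AllPairs.map (Apart-mono s κ≤κ′) (apart s))
      ; oldWaste = oldWaste
      ; curWaste = ℕ.≤-trans (ℕ.*-monoʳ-≤ E (ℕ.≤-trans (ℕ.n≤1+n _) (ℕ.≤-reflexive (sym (Split-waste split)))))
                     (ℕ.≤-trans curWaste (ℕ.≤-trans (ℕ.n≤1+n _) (ℕ.≤-reflexive (sym len))))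
      ; paid     = pay κ′ (2 ℕ.* (C ℕ.* 2 ℕ.^ suc j)) scale≥0 (Split-variation (Split-++ old split)) spent paid′
                     (ℕ.≤-reflexive (trans (eq C (2 ℕ.^ suc j) (weight cur′) _)
                       (cong₂ ℕ._+_ (cong (2 ℕ.* C ℕ.*_) (sym (Split-weight split)))
                         (cong (budget q′) (trans (cong (length cur ℕ.+_) (Split-waste split))
                           (trans (ℕ.+-suc (length cur) (waste cur′)) (cong (ℕ._+ waste cur′) (sym len))))))))
      }
      where
      len : length cur′ ≡ suc (length cur)
      len = Split-length split
      j≤N : j ℕ.≤ N
      j≤N = ℕ.≤-trans (ℕ.n≤1+n j) (Split-level split levels)
      d = ∣ y - x ∣
      spent : fromℕ κ′ * (d + d) ≤ fromℕ (2 ℕ.* (C ℕ.* 2 ℕ.^ suc j)) * D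
      spent = begin
        fromℕ κ′ * (d + d)                           ≡⟨ distribˡ (fromℕ κ′) d d ⟩
        fromℕ κ′ * d + fromℕ κ′ * d                  ≤⟨ +-mono-≤ near near ⟩
        _ + _                                        ≡⟨ sym (double (fromℕ (C ℕ.* 2 ℕ.^ suc j) * D)) ⟩
        fromℕ 2 * (fromℕ (C ℕ.* 2 ℕ.^ suc j) * D)    ≡⟨ sym (fromℕ-*-assoc 2 (C ℕ.* 2 ℕ.^ suc j) D) ⟩
        fromℕ (2 ℕ.* (C ℕ.* 2 ℕ.^ suc j)) * D        ∎
        where open ≤-Reasoning
      eq : ∀ C k w u → 2 ℕ.* (C ℕ.* k) ℕ.+ 2 ℕ.* C ℕ.* w ℕ.+ u ≡ 2 ℕ.* C ℕ.* (k ℕ.+ w) ℕ.+ u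
      eq = solve-∀

    -- The cost so far is at most `2 * Γ * D ≤ Γ * D′`, the inherited part of the new budget,
    -- because the range has doubled. The jump to `y` costs at most `D′`, and `G ≥ 1` covers it.
    restart-preserves : length cur ℕ.≤ n → fromℕ 2 * D ≤ (hi ⊔ y) - (lo ⊓ y) →
      Invariant (state (old ++ cur) [ cell 0 y 0 ] 0 (lo ⊓ y) (hi ⊔ y) ((hi ⊔ y) - (lo ⊓ y)))
    restart-preserves t≤n far = record
      { scale≥0  = D′≥0
      ; range    = ≤-trans (≤-reflexive (sym (+-identityʳ D′)))
                     (≤-trans (+-monoʳ-≤ D′ D′≥0) (≤-reflexive (sym (double D′))))
      ; inside   = Inside-new {lo} {hi} y ∷ []
      ; t≤κ      = ℕ.≤-refl
      ; κ≤2t     = ℕ.s≤s ℕ.z≤n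
      ; levels   = (λ { before → ℕ.z≤n ; after → ℕ.z≤n }) ∷ []
      ; apart    = λ _ → [] ∷ []
      ; oldWaste = begin
          E ℕ.* waste (old ++ cur)                ≡⟨ cong (E ℕ.*_) (total-++ gapSize old cur) ⟩
          E ℕ.* (waste old ℕ.+ waste cur)         ≡⟨ ℕ.*-distribˡ-+ E (waste old) (waste cur) ⟩
          E ℕ.* waste old ℕ.+ E ℕ.* waste cur     ≤⟨ ℕ.+-mono-≤ oldWaste curWaste ⟩
          length old ℕ.+ length cur               ≡⟨ sym (List.length-++ old) ⟩
          length (old ++ cur)                     ∎
      ; curWaste = ℕ.≤-trans (ℕ.≤-reflexive (ℕ.*-zeroʳ E)) ℕ.z≤n
      ; paid     = mkPaid payment
      }
      where
      open ℕ.≤-Reasoning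
      D′ = (hi ⊔ y) - (lo ⊓ y)
      D′≥0 : 0# ≤ D′
      D′≥0 = ≤-trans (*-nonNeg (fromℕ≥0 2) scale≥0) far
      V  = variation (elts (old ++ cur))
      V′ = variation (elts ((old ++ cur) ++ [ cell 0 y 0 ]))
      V≤ : V ≤ fromℕ Γ * D′
      V≤ = ≤-trans (variation-bound I t≤n) (≤-trans
        (≤-reflexive (trans (cong (λ k → fromℕ k * D) (ℕ.*-comm 2 Γ)) (fromℕ-*-assoc Γ 2 D)))
        (*-monoˡ (fromℕ≥0 Γ) far))
      V′≤ : V′ ≤ V + D′
      V′≤ = snoc-variation old cur (cell 0 y 0) (length≥1 I) (Inside-mono y inside) (Inside-new {lo} {hi} y)
      budget≥ : Γ ℕ.+ 1 ℕ.≤ budget 0 (1 ℕ.+ 0)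
      budget≥ = begin
        Γ ℕ.+ 1                                     ≤⟨ ℕ.+-monoʳ-≤ Γ G≥1 ⟩
        Γ ℕ.+ G                                     ≡⟨ eq Γ G ⟩
        budget 0 (1 ℕ.+ 0)                          ∎
        where
        eq : ∀ a b → a ℕ.+ b ≡ 1 ℕ.* a ℕ.+ 1 ℕ.* b ℕ.* 0 ℕ.+ b ℕ.* (1 ℕ.+ 0)
        eq = solve-∀
      payment : fromℕ 1 * V′ + fromℕ (2 ℕ.* C ℕ.* 0) * D′ ≤ fromℕ (budget 0 (1 ℕ.+ 0)) * D′
      payment = ≤-trans (≤-reflexive (trans
          (cong₂ _+_ (trans (cong (_* V′) fromℕ-1) (*-identityˡ V′))
                     (trans (cong (λ k → fromℕ k * D′) (ℕ.*-zeroʳ (2 ℕ.* C))) (zeroˡ D′)))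
          (+-identityʳ V′)))
        (≤-trans V′≤ (≤-trans (+-monoˡ-≤ D′ V≤)
          (≤-trans (≤-reflexive (sym (trans (fromℕ-+-* Γ 1 D′) (cong (fromℕ Γ * D′ +_) (trans (cong (_* D′) fromℕ-1) (*-identityˡ D′))))))
            (fromℕ-*-mono D′≥0 budget≥))))

    -- The `1 + 2 * g` opened cells bring `G` units each. These pay for a jump of at most `2 * D`
    -- and for the potential of the two fresh gaps.
    extend-preserves : suc (length cur) ℕ.≤ n → (hi ⊔ y) - (lo ⊓ y) ≤ fromℕ 2 * D →
      (∀ i → i ℕ.< N → All (Crowding.FarFrom R C κ′ D y (suc i)) cur) →
      let j = freshLevel (suc (length cur)) in
      Invariant (state old (cur ∷ʳ cell j y j) q′ (lo ⊓ y) (hi ⊔ y) D)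
    extend-preserves t′≤n fits far = record
      { scale≥0  = scale≥0
      ; range    = fits
      ; inside   = All.∷ʳ⁺ inside′ (Inside-new {lo} {hi} y)
      ; t≤κ      = ℕ.≤-trans (ℕ.≤-reflexive len) 1+t≤κ′
      ; κ≤2t     = ℕ.≤-trans κ′≤ (ℕ.≤-reflexive (cong (2 ℕ.*_) (sym len)))
      ; levels   = All.∷ʳ⁺ levels λ { before → j≤N ; after → j≤N }
      ; apart    = λ s → AllPairs.++⁺ (apart′ s) ([] ∷ []) (new-apart s j≤N far)
      ; oldWaste = oldWaste
      ; curWaste = waste≤
      ; paid     = pay κ′ (2 ℕ.* κ′) scale≥0
                     (subst (λ cs → variation (elts cs) ≤ variation (elts (old ++ cur)) + D′) (List.++-assoc old cur [ c ])
                       (snoc-variation old cur c (length≥1 I) inside′ (Inside-new {lo} {hi} y)))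
                     spent paid′ enough
      }
      where
      t′ = suc (length cur)
      x = t′ ℕ./ (4 ℕ.* E)
      j = freshLevel t′
      g = gapSize j
      c = cell j y j
      D′ = (hi ⊔ y) - (lo ⊓ y)
      inside′ : All (Inside (lo ⊓ y) (hi ⊔ y)) cur
      inside′ = Inside-mono y inside
      apart′ : ∀ s → AllPairs (Crowding.Apart R C κ′ D s) cur
      apart′ s = AllPairs.map (Apart-mono s κ≤κ′) (apart s)
      len : length (cur ∷ʳ c) ≡ t′
      len = trans (List.length-++ cur) (ℕ.+-comm (length cur) 1)
      2^j≤1+x : suc g ℕ.≤ suc x
      2^j≤1+x = subst (ℕ._≤ suc x) (sym (1+gapSize≡2^ j)) (proj₁ (proj₂ (floorLog x)))
      1+x<2^[1+j] : suc x ℕ.< 2 ℕ.* suc g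
      1+x<2^[1+j] = subst (λ k → suc x ℕ.< 2 ℕ.* k) (sym (1+gapSize≡2^ j)) (proj₂ (proj₂ (floorLog x)))
      j≤N : j ℕ.≤ N
      j≤N = ℕ.≤-pred (2^-cancel-< (begin-strict
        2 ℕ.^ j      ≤⟨ proj₁ (proj₂ (floorLog x)) ⟩
        suc x        ≤⟨ ℕ.m/n<m t′ (4 ℕ.* E) (ℕ.*-mono-≤ {2} {4} (ℕ.s≤s (ℕ.s≤s ℕ.z≤n)) (ℕ.s≤s (ℕ.z≤n {e}))) ⟩
        t′           ≤⟨ t′≤n ⟩
        n            <⟨ n<2^[1+N] ⟩
        2 ℕ.^ suc N  ∎))
        where open ℕ.≤-Reasoning
      new-apart : ∀ s {j cs} → j ℕ.≤ N → (∀ i → i ℕ.< N → All (Crowding.FarFrom R C κ′ D y (suc i)) cs) →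
        All (λ d → All (Crowding.Apart R C κ′ D s d) [ cell j y j ]) cs
      new-apart s {cs = []} j≤N far = []
      new-apart s {j} {d ∷ cs} j≤N far =
        (Crowding.Apart-sym R C κ′ D s (Crowding.FarFrom⇒Apart R C κ′ D s λ { i refl → All.head (far i j≤N) }) ∷ [])
        ∷ new-apart s j≤N λ i i<N → All.tail (far i i<N)
      C*w≤ : C ℕ.* waste cur ℕ.≤ 4 ℕ.* N ℕ.* κ′
      C*w≤ = Crowding.waste-bound R C κ′ D y (proj₁ (Inside-new {lo} {hi} y)) (proj₂ (Inside-new {lo} {hi} y)) scale≥0 fits
        N cur levels apart′ far inside′
      -- The constant 16 in `C` is chosen here: `C * w ≤ 4 * N * κ′ ≤ 8 * N * t′` confines the
      -- existing gaps to half of the allowance `t′ / E` and leaves the other half to the fresh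
      -- ones.
      2Ew≤t′ : 2 ℕ.* (E ℕ.* waste cur) ℕ.≤ t′
      2Ew≤t′ = cancel (8 ℕ.* N) (ℕ.*-mono-≤ {1} {8} (ℕ.s≤s ℕ.z≤n) N≥1) (begin
        8 ℕ.* N ℕ.* (2 ℕ.* (E ℕ.* waste cur))     ≡⟨ eq N E (waste cur) ⟩
        16 ℕ.* (E ℕ.* N) ℕ.* waste cur            ≡⟨ cong (ℕ._* waste cur) (sym C≡) ⟩
        C ℕ.* waste cur                           ≤⟨ C*w≤ ⟩
        4 ℕ.* N ℕ.* κ′                            ≤⟨ ℕ.*-monoʳ-≤ (4 ℕ.* N) κ′≤ ⟩
        4 ℕ.* N ℕ.* (2 ℕ.* t′)                    ≡⟨ eq′ N t′ ⟩
        8 ℕ.* N ℕ.* t′                            ∎)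
        where
        open ℕ.≤-Reasoning
        cancel : ∀ k {a b} → 1 ℕ.≤ k → k ℕ.* a ℕ.≤ k ℕ.* b → a ℕ.≤ b
        cancel (suc k) _ = ℕ.*-cancelˡ-≤ (suc k)
        eq : ∀ N E w → 8 ℕ.* N ℕ.* (2 ℕ.* (E ℕ.* w)) ≡ 16 ℕ.* (E ℕ.* N) ℕ.* w
        eq = solve-∀
        eq′ : ∀ N t → 4 ℕ.* N ℕ.* (2 ℕ.* t) ≡ 8 ℕ.* N ℕ.* t
        eq′ = solve-∀
      waste-snoc : waste (cur ∷ʳ c) ≡ waste cur ℕ.+ (g ℕ.+ g)
      waste-snoc = trans (total-++ gapSize cur [ c ]) (cong (waste cur ℕ.+_) (ℕ.+-identityʳ (g ℕ.+ g)))
      weight-snoc : weight (cur ∷ʳ c) ≡ weight cur ℕ.+ (j ℕ.* suc g ℕ.+ j ℕ.* suc g)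
      weight-snoc = trans (total-++ (λ i → i ℕ.* 2 ℕ.^ i) cur [ c ])
        (cong (weight cur ℕ.+_) (trans (ℕ.+-identityʳ _) (cong (λ k → j ℕ.* k ℕ.+ j ℕ.* k) (sym (1+gapSize≡2^ j)))))
      waste≤ : E ℕ.* waste (cur ∷ʳ c) ℕ.≤ length (cur ∷ʳ c)
      waste≤ = ℕ.*-cancelˡ-≤ 2 (begin
        2 ℕ.* (E ℕ.* waste (cur ∷ʳ c))                     ≡⟨ cong (λ w → 2 ℕ.* (E ℕ.* w)) waste-snoc ⟩
        2 ℕ.* (E ℕ.* (waste cur ℕ.+ (g ℕ.+ g)))            ≡⟨ eq E (waste cur) g ⟩
        2 ℕ.* (E ℕ.* waste cur) ℕ.+ g ℕ.* (4 ℕ.* E)        ≤⟨ ℕ.+-mono-≤ 2Ew≤t′ (ℕ.*-monoˡ-≤ (4 ℕ.* E) (ℕ.≤-pred 2^j≤1+x)) ⟩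
        t′ ℕ.+ x ℕ.* (4 ℕ.* E)                             ≤⟨ ℕ.+-monoʳ-≤ t′ (ℕ.m/n*n≤m t′ (4 ℕ.* E)) ⟩
        t′ ℕ.+ t′                                          ≡⟨ cong (t′ ℕ.+_) (sym (ℕ.+-identityʳ t′)) ⟩
        2 ℕ.* t′                                           ≡⟨ cong (2 ℕ.*_) (sym len) ⟩
        2 ℕ.* length (cur ∷ʳ c)                            ∎)
        where
        open ℕ.≤-Reasoning
        eq : ∀ E w g → 2 ℕ.* (E ℕ.* (w ℕ.+ (g ℕ.+ g))) ≡ 2 ℕ.* (E ℕ.* w) ℕ.+ g ℕ.* (4 ℕ.* E)
        eq = solve-∀
      -- As `j` is the largest permitted level, at least `κ′ / C` cells are opened, and the jump can
      -- be charged to them.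
      κ′≤C*[1+2g] : κ′ ℕ.≤ C ℕ.* suc (g ℕ.+ g)
      κ′≤C*[1+2g] = begin
        κ′                                       ≤⟨ κ′≤ ⟩
        2 ℕ.* t′                                 ≤⟨ ℕ.*-monoʳ-≤ 2 (ℕ.<⇒≤ (m<n*[1+m/n] t′ (4 ℕ.* E))) ⟩
        2 ℕ.* (4 ℕ.* E ℕ.* suc x)                ≤⟨ ℕ.*-monoʳ-≤ 2 (ℕ.*-monoʳ-≤ (4 ℕ.* E) (ℕ.<⇒≤ 1+x<2^[1+j])) ⟩
        2 ℕ.* (4 ℕ.* E ℕ.* (2 ℕ.* suc g))        ≡⟨ eq E (suc g) ⟩
        16 ℕ.* (E ℕ.* 1) ℕ.* suc g               ≤⟨ ℕ.*-mono-≤ (ℕ.*-monoʳ-≤ 16 (ℕ.*-monoʳ-≤ E N≥1)) (ℕ.s≤s (ℕ.m≤m+n g g)) ⟩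
        16 ℕ.* (E ℕ.* N) ℕ.* suc (g ℕ.+ g)       ≡⟨ cong (ℕ._* suc (g ℕ.+ g)) (sym C≡) ⟩
        C ℕ.* suc (g ℕ.+ g)                      ∎
        where
        open ℕ.≤-Reasoning
        eq : ∀ E k → 2 ℕ.* (4 ℕ.* E ℕ.* (2 ℕ.* k)) ≡ 16 ℕ.* (E ℕ.* 1) ℕ.* k
        eq = solve-∀
      spent : fromℕ κ′ * D′ ≤ fromℕ (2 ℕ.* κ′) * D
      spent = ≤-trans (*-monoˡ (fromℕ≥0 κ′) fits)
        (≤-reflexive (trans (sym (fromℕ-*-assoc κ′ 2 D)) (cong (λ k → fromℕ k * D) (ℕ.*-comm κ′ 2))))
      -- Per opened cell the jump takes at most `2 * C` units and the fresh potential at most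
      -- `2 * C * (2 * N)`, which add up to `G`.
      enough : 2 ℕ.* κ′ ℕ.+ 2 ℕ.* C ℕ.* weight (cur ∷ʳ c) ℕ.+ budget q′ (length cur ℕ.+ waste cur) ℕ.≤
        2 ℕ.* C ℕ.* weight cur ℕ.+ budget q′ (length (cur ∷ʳ c) ℕ.+ waste (cur ∷ʳ c))
      enough = begin
        2 ℕ.* κ′ ℕ.+ 2 ℕ.* C ℕ.* weight (cur ∷ʳ c) ℕ.+ (B ℕ.+ G ℕ.* s)
          ≡⟨ cong (λ w → 2 ℕ.* κ′ ℕ.+ 2 ℕ.* C ℕ.* w ℕ.+ (B ℕ.+ G ℕ.* s)) weight-snoc ⟩
        2 ℕ.* κ′ ℕ.+ 2 ℕ.* C ℕ.* (weight cur ℕ.+ (j ℕ.* suc g ℕ.+ j ℕ.* suc g)) ℕ.+ (B ℕ.+ G ℕ.* s)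
          ≤⟨ ℕ.+-monoˡ-≤ _ (ℕ.+-mono-≤ (ℕ.*-monoʳ-≤ 2 κ′≤C*[1+2g]) (ℕ.*-monoʳ-≤ (2 ℕ.* C) (ℕ.+-monoʳ-≤ (weight cur) (ℕ.+-mono-≤ jg≤ jg≤)))) ⟩
        2 ℕ.* (C ℕ.* o) ℕ.+ 2 ℕ.* C ℕ.* (weight cur ℕ.+ (N ℕ.* o ℕ.+ N ℕ.* o)) ℕ.+ (B ℕ.+ G ℕ.* s)
          ≡⟨ lhs C N o (weight cur) (B ℕ.+ G ℕ.* s) ⟩
        2 ℕ.* C ℕ.* weight cur ℕ.+ (B ℕ.+ G ℕ.* s ℕ.+ 2 ℕ.* C ℕ.* suc (2 ℕ.* N) ℕ.* o)
          ≡⟨ cong (λ a → 2 ℕ.* C ℕ.* weight cur ℕ.+ (B ℕ.+ G ℕ.* s ℕ.+ a ℕ.* o)) (sym G≡) ⟩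
        2 ℕ.* C ℕ.* weight cur ℕ.+ (B ℕ.+ G ℕ.* s ℕ.+ G ℕ.* o)
          ≡⟨ cong (2 ℕ.* C ℕ.* weight cur ℕ.+_) (trans (rhs B G (length cur) (waste cur) g) (cong (λ k → B ℕ.+ G ℕ.* k) (sym (cong₂ ℕ._+_ len waste-snoc)))) ⟩
        2 ℕ.* C ℕ.* weight cur ℕ.+ (B ℕ.+ G ℕ.* (length (cur ∷ʳ c) ℕ.+ waste (cur ∷ʳ c))) ∎
        where
        open ℕ.≤-Reasoning
        B = 2 ℕ.^ q′ ℕ.* Γ ℕ.+ 2 ℕ.^ q′ ℕ.* G ℕ.* q′
        s = length cur ℕ.+ waste cur
        o = suc (g ℕ.+ g)
        jg≤ : j ℕ.* suc g ℕ.≤ N ℕ.* o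
        jg≤ = ℕ.*-mono-≤ j≤N (ℕ.s≤s (ℕ.m≤m+n g g))
        lhs : ∀ C N o w b → 2 ℕ.* (C ℕ.* o) ℕ.+ 2 ℕ.* C ℕ.* (w ℕ.+ (N ℕ.* o ℕ.+ N ℕ.* o)) ℕ.+ b ≡
          2 ℕ.* C ℕ.* w ℕ.+ (b ℕ.+ 2 ℕ.* C ℕ.* suc (2 ℕ.* N) ℕ.* o)
        lhs = solve-∀
        rhs : ∀ B G t w g → B ℕ.+ G ℕ.* (t ℕ.+ w) ℕ.+ G ℕ.* suc (g ℕ.+ g) ≡ B ℕ.+ G ℕ.* (suc t ℕ.+ (w ℕ.+ (g ℕ.+ g)))
        rhs = solve-∀

-- Realisation as an online algorithm on an array.

module Execution (R : RealNumbers) (N e C G n m : ℕ) (C≡ : C ≡ 16 ℕ.* (suc e ℕ.* N)) (G≡ : G ≡ 2 ℕ.* C ℕ.* suc (2 ℕ.* N))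
                 (N≥1 : 1 ℕ.≤ N) (n<2^[1+N] : n ℕ.< 2 ℕ.^ suc N) (n+n/E≡1+m : n ℕ.+ n ℕ./ suc e ≡ suc m) where
  open OrderedField R
  open Cells R
  open Accounting R
  open GapSplitting R N e C G
  open Preservation R N e C G n C≡ G≡ N≥1 n<2^[1+N]

  -- All that the array sees of a step. A restart appears as appending a block without gaps.
  data Place (y : ℝ) : List Cell → List Cell → Set where
    split  : ∀ {x j cs cs′} → Split y x j cs cs′ → Place y cs cs′
    append : ∀ {cs cs′} j → cs′ ≡ cs ++ [ cell j y j ] → Place y cs cs′

  position : ∀ {y cs cs′} → Place y cs cs′ → ℕ
  position (split s)           = length (proj₁ (Split-contents s))
  position (append {cs = cs} j _) = length (contents cs) ℕ.+ gapSize j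

  Place-length : ∀ {y cs cs′} → Place y cs cs′ → length cs′ ≡ suc (length cs)
  Place-length (split s) = Split-length s
  Place-length (append {cs = cs} j refl) = trans (List.length-++ cs) (ℕ.+-comm (length cs) 1)

  FillAt : ℕ → ℝ → List (Maybe ℝ) → List (Maybe ℝ) → Set
  FillAt p y as bs = ∃₂ λ P Q → length P ≡ p × as ≡ P ++ nothing ∷ Q × bs ≡ P ++ just y ∷ Q

  -- Here `r` counts the empty cells behind all blocks. A split leaves it unchanged; appending
  -- consumes `gapSize (suc j)` of them, two gaps and one element.
  Place-contents : ∀ {y cs cs′} (p : Place y cs cs′) r →
    length (contents cs′) ℕ.≤ length (contents cs) ℕ.+ r →
    ∃ λ r′ → FillAt (position p) y (contents cs ++ replicate r nothing) (contents cs′ ++ replicate r′ nothing)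
  Place-contents (split s) r _ with Split-contents s
  ... | P , Q , eq , eq′ rewrite eq | eq′ =
    r , P , Q ++ replicate r nothing , refl , List.++-assoc P _ _ , List.++-assoc P _ _
  Place-contents {y} (append {cs = cs} j refl) r room = r′ , contents cs ++ free j , free j ++ replicate r′ nothing ,
      trans (List.length-++ (contents cs)) (cong (length (contents cs) ℕ.+_) (length-free j)) ,
      (begin
        contents cs ++ replicate r nothing                                   ≡⟨ cong (λ k → contents cs ++ replicate k nothing) (sym o+r′≡r) ⟩
        contents cs ++ replicate (gapSize (suc j) ℕ.+ r′) nothing            ≡⟨ cong (contents cs ++_) (sym (replicate-++ (gapSize (suc j)) r′)) ⟩
        contents cs ++ replicate (gapSize (suc j)) nothing ++ replicate r′ nothing ≡⟨ cong (λ u → contents cs ++ u ++ replicate r′ nothing) (sym (free≡replicate (suc j))) ⟩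
        contents cs ++ (free j ++ nothing ∷ free j) ++ replicate r′ nothing  ≡⟨ cong (contents cs ++_) (List.++-assoc (free j) _ _) ⟩
        contents cs ++ free j ++ nothing ∷ free j ++ replicate r′ nothing    ≡⟨ sym (List.++-assoc (contents cs) _ _) ⟩
        (contents cs ++ free j) ++ nothing ∷ free j ++ replicate r′ nothing  ∎) ,
      (begin
        contents (cs ++ [ c ]) ++ replicate r′ nothing                       ≡⟨ cong (_++ replicate r′ nothing) contents-snoc ⟩
        (contents cs ++ block c) ++ replicate r′ nothing                     ≡⟨ List.++-assoc (contents cs) _ _ ⟩
        contents cs ++ (free j ++ just y ∷ free j) ++ replicate r′ nothing   ≡⟨ cong (contents cs ++_) (List.++-assoc (free j) _ _) ⟩
        contents cs ++ free j ++ just y ∷ free j ++ replicate r′ nothing     ≡⟨ sym (List.++-assoc (contents cs) _ _) ⟩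
        (contents cs ++ free j) ++ just y ∷ free j ++ replicate r′ nothing   ∎)
    where
    open ≡-Reasoning
    c = cell j y j
    r′ = r ℕ.∸ gapSize (suc j)
    contents-snoc : contents (cs ++ [ c ]) ≡ contents cs ++ block c
    contents-snoc = trans (List.concatMap-++ block cs [ c ]) (cong (contents cs ++_) (List.++-identityʳ (block c)))
    length-block : length (block c) ≡ gapSize (suc j)
    length-block = trans (List.length-++ (free j)) (cong₂ (λ u v → u ℕ.+ suc v) (length-free j) (length-free j))
    o+r′≡r : gapSize (suc j) ℕ.+ r′ ≡ r
    o+r′≡r = ℕ.m+[n∸m]≡n (ℕ.+-cancelˡ-≤ (length (contents cs)) _ _
      (subst (ℕ._≤ length (contents cs) ℕ.+ r)
        (trans (cong length contents-snoc) (trans (List.length-++ (contents cs)) (cong (length (contents cs) ℕ.+_) length-block))) room))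

  Step⇒Place : ∀ {y st st′} → Step y st st′ → Place y (State.cells st) (State.cells st′)
  Step⇒Place (refine {old} _ _ s _)    = split (Split-++ old s)
  Step⇒Place (extend {old} {cur} _ _)  = append _ (sym (List.++-assoc old cur _))
  Step⇒Place (restart _)               = append 0 refl

  Step-preserves : ∀ {y st st′} → Step y st st′ → suc (length (State.cells st)) ℕ.≤ n → Invariant st → Invariant st′
  Step-preserves {st = st} step 1+t≤n I = preserve step
    where
    open State st
    cur≤ : suc (length cur) ℕ.≤ n
    cur≤ = ℕ.≤-trans (ℕ.s≤s (ℕ.≤-trans (ℕ.m≤n+m _ (length old)) (ℕ.≤-reflexive (sym (List.length-++ old))))) 1+t≤n
    preserve : ∀ {y st′} → Step y st st′ → Invariant st′
    preserve (refine fits near s far) = refine-preserves I fits near s far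
    preserve (extend fits far)        = extend-preserves I cur≤ fits far
    preserve (restart exceeds)        = restart-preserves I (ℕ.<⇒≤ cur≤) exceeds

  start-invariant : ∀ y → Invariant (start y)
  start-invariant y = record
    { scale≥0  = ≤-refl
    ; range    = ≤-reflexive (trans (-‿inverseʳ y) (sym (zeroʳ _)))
    ; inside   = (≤-refl , ≤-refl) ∷ []
    ; t≤κ      = ℕ.≤-refl
    ; κ≤2t     = ℕ.s≤s ℕ.z≤n
    ; levels   = (λ { before → ℕ.z≤n ; after → ℕ.z≤n }) ∷ []
    ; apart    = λ _ → [] ∷ []
    ; oldWaste = ℕ.≤-reflexive (ℕ.*-zeroʳ E)
    ; curWaste = ℕ.≤-trans (ℕ.≤-reflexive (ℕ.*-zeroʳ E)) ℕ.z≤n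
    ; paid     = mkPaid (≤-reflexive (trans (cong₂ _+_ (zeroʳ _) (zeroʳ _)) (trans (+-identityˡ _) (sym (zeroʳ _)))))
    }

  -- Meant for the extremes `a` and `b` of the whole input: then the scale never exceeds the
  -- optimum, which only the analysis knows.
  Bounded : ℝ → ℝ → State → Set
  Bounded a b st = a ≤ low × high ≤ b × scale ≤ b - a
    where open State st

  Step-bounded : ∀ {a b y st st′} → Step y st st′ → a ≤ y → y ≤ b → Bounded a b st → Bounded a b st′
  Step-bounded {a} {b} {y} step a≤y y≤b (a≤lo , hi≤b , scale≤) = bounded step
    where
    bounded : ∀ {st′} → Step y _ st′ → Bounded a b st′
    bounded (refine _ _ _ _) = ⊓-glb a≤lo a≤y , ⊔-lub hi≤b y≤b , scale≤
    bounded (extend _ _)     = ⊓-glb a≤lo a≤y , ⊔-lub hi≤b y≤b , scale≤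
    bounded (restart _)      = ⊓-glb a≤lo a≤y , ⊔-lub hi≤b y≤b ,
      x-y≤z (≤-trans (⊔-lub hi≤b y≤b) (≤-trans (≤-reflexive (sym (x-y+y≡x b a))) (+-monoʳ-≤ (b - a) (⊓-glb a≤lo a≤y))))

  -- The state is recomputed from the history, the only memory that an algorithm has.
  stateAfter : ℝ → List ℝ → State
  stateAfter x h = foldl (λ st y → proj₁ (step y st)) (start x) h

  toCell : ℕ → Fin (suc m)
  toCell p with p ℕ.<? suc m
  ... | yes p<1+m = fromℕ< p<1+m
  -- A default that is not reached in a run on `n` elements, where positions stay inside the array.
  ... | no  _     = Fin.zero

  toℕ-toCell : ∀ {p} → p ℕ.< suc m → toℕ (toCell p) ≡ p
  toℕ-toCell {p} p< with p ℕ.<? suc m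
  ... | yes p<1+m = Fin.toℕ-fromℕ< p<1+m
  ... | no  p≮    = contradiction p< p≮

  algorithm : Algorithm (suc m)
  algorithm []      y = Fin.zero
  algorithm (x ∷ h) y = toCell (position (Step⇒Place (proj₂ (step y (stateAfter x h)))))

  fill-array : ∀ {k} (A : Array k) {y as′} (i : Fin k) → FillAt (toℕ i) y (toList A) as′ →
    lookup A i ≡ nothing × toList (A [ i ]≔ just y) ≡ as′
  fill-array (a ∷ A) Fin.zero    ([]    , Q , _  , refl , refl) = refl , refl
  fill-array (a ∷ A) (Fin.suc i) (p ∷ P , Q , eq , eq₁ , refl) with
    fill-array A i (P , Q , ℕ.suc-injective eq , List.∷-injectiveʳ eq₁ , refl)
  ... | empty , filled = empty , cong₂ _∷_ (List.∷-injectiveˡ eq₁) filled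

  -- Adding the invariants for old and current cells gives `E * waste ≤ n`, and the waste is an
  -- integer.
  contents≤m : ∀ {st} → Invariant st → length (State.cells st) ℕ.≤ n → length (contents (State.cells st)) ℕ.≤ suc m
  contents≤m {st} I len≤n = begin
    length (contents cells)          ≡⟨ length-contents cells ⟩
    length cells ℕ.+ waste cells     ≤⟨ ℕ.+-mono-≤ len≤n waste≤ ⟩
    n ℕ.+ n ℕ./ E                    ≡⟨ n+n/E≡1+m ⟩
    suc m                            ∎
    where
    open ℕ.≤-Reasoning
    open State st
    open Invariant I
    waste≤ : waste cells ℕ.≤ n ℕ./ E
    waste≤ = begin
      waste cells                    ≡⟨ sym (ℕ.m*n/n≡m (waste cells) E) ⟩
      (waste cells ℕ.* E) ℕ./ E      ≤⟨ ℕ./-monoˡ-≤ E (begin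
        waste cells ℕ.* E                   ≡⟨ ℕ.*-comm (waste cells) E ⟩
        E ℕ.* waste cells                   ≡⟨ cong (E ℕ.*_) (total-++ gapSize old cur) ⟩
        E ℕ.* (waste old ℕ.+ waste cur)     ≡⟨ ℕ.*-distribˡ-+ E (waste old) (waste cur) ⟩
        E ℕ.* waste old ℕ.+ E ℕ.* waste cur ≤⟨ ℕ.+-mono-≤ oldWaste curWaste ⟩
        length old ℕ.+ length cur           ≡⟨ sym (List.length-++ old) ⟩
        length cells                        ≤⟨ len≤n ⟩
        n                                   ∎) ⟩
      n ℕ./ E                        ∎

  -- Throughout, the array is the contents of the cells followed by `r` empty cells, so at the end
  -- its cost is the variation of the stored elements. The first element `x` is kept apart because
  -- it determines the starting state.
  run : ∀ xs x h st → stateAfter x h ≡ st → Invariant st → ∀ {a b} → Bounded a b st →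
    All (λ y → a ≤ y × y ≤ b) xs → length (State.cells st) ℕ.+ length xs ≡ n →
    (A : Array (suc m)) → ∀ r → toList A ≡ contents (State.cells st) ++ replicate r nothing →
    ∃ λ B → Run algorithm (x ∷ h) A xs B × cost B ≤ fromℕ (2 ℕ.* Γ) * (b - a)
  run [] x h st _ I {a} {b} (_ , _ , scale≤) _ len A r eq = A , done , (begin
    cost A                                                      ≡⟨ cong (λ l → variation (catMaybes l)) eq ⟩
    variation (catMaybes (contents cells ++ replicate r nothing)) ≡⟨ cong variation (trans (List.catMaybes-++ (contents cells) _) (cong₂ _++_ (catMaybes-contents cells) (catMaybes-nothing r))) ⟩
    variation (elts cells ++ [])                                ≡⟨ cong variation (List.++-identityʳ (elts cells)) ⟩
    variation (elts cells)                                      ≤⟨ variation-bound I cur≤n ⟩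
    fromℕ (2 ℕ.* Γ) * scale                                     ≤⟨ *-monoˡ (fromℕ≥0 (2 ℕ.* Γ)) scale≤ ⟩
    fromℕ (2 ℕ.* Γ) * (b - a)                                   ∎)
    where
    open ≤-Reasoning
    open State st
    catMaybes-nothing : ∀ r → catMaybes {A = ℝ} (replicate r nothing) ≡ []
    catMaybes-nothing zero    = refl
    catMaybes-nothing (suc r) = catMaybes-nothing r
    cur≤n : length cur ℕ.≤ n
    cur≤n = ℕ.≤-trans (ℕ.m≤n+m _ (length old)) (ℕ.≤-reflexive (trans (sym (List.length-++ old)) (trans (sym (ℕ.+-identityʳ _)) len)))
  run (y ∷ xs) x h st refl I {a} {b} bounded ((a≤y , y≤b) ∷ within) len A r eq =
    let B , rest , cost≤ = run xs x (h ∷ʳ y) st′ (List.foldl-∷ʳ (λ st y → proj₁ (step y st)) (start x) y h) I′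
                             (Step-bounded next a≤y y≤b bounded) within
                             (trans (cong (ℕ._+ length xs) len′) (trans (sym (ℕ.+-suc (length (State.cells st)) (length xs))) len))
                             (A [ algorithm (x ∷ h) y ]≔ just y) (proj₁ filled) (proj₂ at)
    in  B , insert (proj₁ at) rest , cost≤
    where
    next = proj₂ (step y st)
    st′ = proj₁ (step y st)
    p = Step⇒Place next
    len′ : length (State.cells st′) ≡ suc (length (State.cells st))
    len′ = Place-length p
    1+len≤n : suc (length (State.cells st)) ℕ.≤ n
    1+len≤n = ℕ.≤-trans (ℕ.m≤m+n _ (length xs)) (ℕ.≤-reflexive (trans (sym (ℕ.+-suc (length (State.cells st)) (length xs))) len))
    I′ : Invariant st′
    I′ = Step-preserves next 1+len≤n I
    lengthA : length (contents (State.cells st)) ℕ.+ r ≡ suc m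
    lengthA = trans (cong (length (contents (State.cells st)) ℕ.+_) (sym (List.length-replicate r)))
      (trans (sym (List.length-++ (contents (State.cells st)))) (trans (cong length (sym eq)) (Vec.length-toList A)))
    filled = Place-contents p r (ℕ.≤-trans (contents≤m I′ (ℕ.≤-trans (ℕ.≤-reflexive len′) 1+len≤n)) (ℕ.≤-reflexive (sym lengthA)))
    at : lookup A (algorithm (x ∷ h) y) ≡ nothing ×
         toList (A [ algorithm (x ∷ h) y ]≔ just y) ≡ contents (State.cells st′) ++ replicate (proj₁ filled) nothing
    at with filled
    ... | r′ , P , Q , pos , eq₁ , eq₂ = fill-array A (algorithm (x ∷ h) y)
      (P , Q , trans pos (sym (toℕ-toCell p<)) , trans eq eq₁ , eq₂)
      where
      p< : position p ℕ.< suc m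
      p< = ℕ.≤-trans (ℕ.≤-trans (ℕ.s≤s (ℕ.≤-reflexive (sym pos))) (ℕ.≤-trans (ℕ.m≤m+n (suc (length P)) (length Q)) (ℕ.≤-reflexive (trans (sym (ℕ.+-suc (length P) (length Q))) (sym (List.length-++ P))))))
        (ℕ.≤-reflexive (trans (cong length (sym (trans eq eq₁))) (Vec.length-toList A)))

  competitive : ∀ n′ → n ≡ suc n′ → Competitive n algorithm (fromℕ (2 ℕ.* Γ))
  competitive n′ refl (x ∷ xs) with elements-bounded x xs
  ... | (a≤x , x≤b) , within =
    let B , rest , cost≤ = run (toList xs) x [] (start x) refl (start-invariant x)
                             (a≤x , x≤b , sub≥0 (≤-trans a≤x x≤b)) within (cong suc (Vec.length-toList xs))
                             (just x ∷ Vec.replicate m nothing) m (cong (just x ∷_) (Vec.toList-replicate m nothing))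
    in  B , insert refl rest , cost≤

-- Choice of the parameters and the competitive ratio.

module Competitiveness (R : RealNumbers) where
  open OrderedField R
  open Cells R
  open Accounting R

  [x/n]*n≡x : ∀ n x → (x / fromℕ (suc n)) * fromℕ (suc n) ≡ x
  [x/n]*n≡x n x = trans (*-assoc x _ _) (trans (cong (x *_)
    (trans (*-comm _ (fromℕ (suc n))) (*-inverseʳ _ (fromℕ-suc≢0 n)))) (*-identityʳ x))

  2^k≤n⇒k≤log₂n : ∀ {k} n → 2 ℕ.^ k ℕ.≤ suc n → fromℕ k ≤ log₂ (suc n)
  2^k≤n⇒k≤log₂n {k} n 2^k≤n = subst (_≤ log₂ (suc n)) k/1≡k
    (proj₁ (proj₂ (log₂-sup n)) (fromℕ k / fromℕ 1)
      (k , 1 , ℕ.s≤s ℕ.z≤n , ℕ.≤-trans 2^k≤n (ℕ.≤-reflexive (sym (ℕ.*-identityʳ (suc n)))) , refl))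
    where
    k/1≡k : fromℕ k / fromℕ 1 ≡ fromℕ k
    k/1≡k = trans (sym (*-identityʳ _)) (trans (cong (fromℕ k / fromℕ 1 *_) (sym fromℕ-1)) ([x/n]*n≡x 0 (fromℕ k)))

  -- Descent to an `E` whose predecessor fails: from `ε * (E - 1) ≤ 1` and `ε ≤ 1` follows
  -- `ε * E ≤ 2`. Thus `1 / E` replaces `ε` up to a factor 2.
  integer-inverse : ∀ {ε} → ε ≤ 1# → ∀ k → 1# ≤ ε * fromℕ (suc k) →
    ∃ λ e → 1# ≤ ε * fromℕ (suc e) × ε * fromℕ (suc e) ≤ fromℕ 2
  integer-inverse {ε} ε≤1 zero 1≤ = 0 , 1≤ , ≤-trans
    (≤-reflexive (trans (cong (ε *_) fromℕ-1) (*-identityʳ ε)))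
    (≤-trans ε≤1 (≤-trans (≤-reflexive (sym fromℕ-1)) (fromℕ-mono-≤ {1} {2} (ℕ.s≤s ℕ.z≤n))))
  integer-inverse {ε} ε≤1 (suc k) 1≤ with 1# ≤? ε * fromℕ (suc k)
  ... | yes 1≤′ = integer-inverse ε≤1 k 1≤′
  ... | no 1≰ = suc k , 1≤ , (begin
    ε * (1# + fromℕ (suc k))         ≡⟨ trans (distribˡ ε 1# _) (cong (_+ ε * fromℕ (suc k)) (*-identityʳ ε)) ⟩
    ε + ε * fromℕ (suc k)            ≤⟨ +-mono-≤ ε≤1 (≰⇒≥ 1≰) ⟩
    1# + 1#                          ≡⟨ cong (1# +_) (sym fromℕ-1) ⟩
    fromℕ 2                          ∎)
    where open ≤-Reasoning

  0<fromℕ-suc : ∀ n → 0# < fromℕ (suc n)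
  0<fromℕ-suc n = fromℕ≥0 (suc n) , λ eq → fromℕ-suc≢0 n (sym eq)

  ^3-mono-≤ : ∀ {x y} → 0# ≤ x → x ≤ y → x * (x * x) ≤ y ^ 3
  ^3-mono-≤ {x} {y} x≥0 x≤y = ≤-trans
    (*-mono-≤ y≥0 (*-nonNeg x≥0 x≥0) x≤y (*-mono-≤ y≥0 x≥0 x≤y x≤y))
    (≤-reflexive (cong (λ z → y * (y * z)) (sym (*-identityʳ y))))
    where y≥0 = ≤-trans x≥0 x≤y

  opt≥0 : ∀ {n} (xs : Vec ℝ n) → 0# ≤ opt xs
  opt≥0 []       = ≤-refl
  opt≥0 (x ∷ xs) = sub≥0 (≤-trans (proj₁ (proj₁ bounds)) (proj₂ (proj₁ bounds)))
    where bounds = elements-bounded x xs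

  Competitive-mono : ∀ {n m} {alg : Algorithm m} {ρ σ} → ρ ≤ σ → Competitive n alg ρ → Competitive n alg σ
  Competitive-mono ρ≤σ competitive xs =
    let B , run , cost≤ = competitive xs in B , run , ≤-trans cost≤ (*-monoʳ (opt≥0 xs) ρ≤σ)

  -- With `1 + 2 * N ≤ 3 * N` and `N + 3 ≤ 4 * N`, the ratio `2 * Γ` is at most
  -- `2 * (32 * E * N * 3 * N) * (4 * N)`, hence 768.
  sorting-scheme : ∀ n′ N e m {C G} → C ≡ 16 ℕ.* (suc e ℕ.* N) → G ≡ 2 ℕ.* C ℕ.* suc (2 ℕ.* N) → 1 ℕ.≤ N →
    suc n′ ℕ.< 2 ℕ.^ suc N → suc n′ ℕ.+ suc n′ ℕ./ suc e ≡ suc m →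
    ∃ λ Δ → Δ ℕ.≤ 768 ℕ.* (suc e ℕ.* (N ℕ.* (N ℕ.* N))) × ∃ λ (alg : Algorithm (suc m)) → Competitive (suc n′) alg (fromℕ Δ)
  sorting-scheme n′ N e m {C} {G} C≡ G≡ N≥1 n< n+n/E≡ = 2 ℕ.* (G ℕ.* (N ℕ.+ 3)) , Δ≤ , algorithm , competitive n′ refl
    where
    open Execution R N e C G (suc n′) m C≡ G≡ N≥1 n< n+n/E≡
    eq : ∀ E N → 2 ℕ.* (2 ℕ.* (16 ℕ.* (E ℕ.* N)) ℕ.* (N ℕ.+ 2 ℕ.* N) ℕ.* (N ℕ.+ 3 ℕ.* N)) ≡
      768 ℕ.* (E ℕ.* (N ℕ.* (N ℕ.* N)))
    eq = solve-∀
    G≤ : G ℕ.≤ 2 ℕ.* (16 ℕ.* (suc e ℕ.* N)) ℕ.* (N ℕ.+ 2 ℕ.* N)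
    G≤ = ℕ.≤-trans (ℕ.≤-reflexive (trans G≡ (cong (λ c → 2 ℕ.* c ℕ.* suc (2 ℕ.* N)) C≡)))
      (ℕ.*-monoʳ-≤ (2 ℕ.* (16 ℕ.* (suc e ℕ.* N))) (ℕ.+-monoˡ-≤ (2 ℕ.* N) N≥1))
    Δ≤ : 2 ℕ.* (G ℕ.* (N ℕ.+ 3)) ℕ.≤ 768 ℕ.* (suc e ℕ.* (N ℕ.* (N ℕ.* N)))
    Δ≤ = ℕ.≤-trans (ℕ.*-monoʳ-≤ 2 (ℕ.*-mono-≤ G≤ (ℕ.+-monoʳ-≤ N (ℕ.*-monoʳ-≤ 3 N≥1)))) (ℕ.≤-reflexive (eq (suc e) N))

  competitive : ∀ n → 2 ℕ.≤ n → ∀ ε → (fromℕ 3 * log₂ n) / fromℕ n ≤ ε → ε ≤ 1# →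
    ∃ λ m → fromℕ m ≤ (1# + ε) * fromℕ n ×
      ∃ λ (alg : Algorithm m) → Competitive n alg (fromℕ 1536 * (log₂ n ^ 3 / ε))
  competitive n@(suc n′) 2≤n ε 3log/n≤ε ε≤1 =
    suc m , space , proj₁ (proj₂ (proj₂ scheme)) , Competitive-mono ratio (proj₂ (proj₂ (proj₂ scheme)))
    where
    open ≤-Reasoning
    L = log₂ n
    N = proj₁ (floorLog n′)
    N≥1 : 1 ℕ.≤ N
    N≥1 = ℕ.≤-pred (2^-cancel-< (ℕ.≤-<-trans 2≤n (proj₂ (proj₂ (floorLog n′)))))
    N≤L : fromℕ N ≤ L
    N≤L = 2^k≤n⇒k≤log₂n {N} n′ (proj₁ (proj₂ (floorLog n′)))

    -- The lower bound on `ε` yields `ε * n ≥ 3 * N ≥ 1`, so the descent for `E` can start at `n`.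
    1≤εn : 1# ≤ ε * fromℕ n
    1≤εn = begin
      1#                                   ≡⟨ sym fromℕ-1 ⟩
      fromℕ 1                              ≤⟨ fromℕ-mono-≤ (ℕ.*-mono-≤ {1} {3} (ℕ.s≤s ℕ.z≤n) N≥1) ⟩
      fromℕ (3 ℕ.* N)                      ≡⟨ fromℕ-* 3 N ⟩
      fromℕ 3 * fromℕ N                    ≤⟨ *-monoˡ (fromℕ≥0 3) N≤L ⟩
      fromℕ 3 * L                          ≡⟨ sym ([x/n]*n≡x n′ _) ⟩
      (fromℕ 3 * L) / fromℕ n * fromℕ n    ≤⟨ *-monoʳ (fromℕ≥0 n) 3log/n≤ε ⟩
      ε * fromℕ n                          ∎

    inverse = integer-inverse ε≤1 n′ 1≤εn
    e = proj₁ inverse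
    E = suc e
    1≤εE : 1# ≤ ε * fromℕ E
    1≤εE = proj₁ (proj₂ inverse)
    εE≤2 : ε * fromℕ E ≤ fromℕ 2
    εE≤2 = proj₂ (proj₂ inverse)
    ε≰0 : ¬ ε ≤ 0#
    ε≰0 ε≤0 = 0≢1 (antisym 1≥0 (≤-trans 1≤εE (≤-trans (*-monoʳ (fromℕ≥0 E) ε≤0) (≤-reflexive (zeroˡ _)))))
    ε≥0 : 0# ≤ ε
    ε≥0 = ≰⇒≥ ε≰0
    ε≢0 : ε ≢ 0#
    ε≢0 ε≡0 = ε≰0 (≤-reflexive ε≡0)

    -- Chosen so that `suc m` is `n + n / E`; the successor form guarantees a first cell.
    m = n′ ℕ.+ n ℕ./ E

    scheme : ∃ λ Δ → Δ ℕ.≤ 768 ℕ.* (E ℕ.* (N ℕ.* (N ℕ.* N))) × ∃ λ (alg : Algorithm (suc m)) → Competitive n alg (fromℕ Δ)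
    scheme = sorting-scheme n′ N e m refl refl N≥1 (proj₂ (proj₂ (floorLog n′))) refl

    space : fromℕ (suc m) ≤ (1# + ε) * fromℕ n
    space = begin
      fromℕ (n ℕ.+ n ℕ./ E)                ≡⟨ fromℕ-+ n (n ℕ./ E) ⟩
      fromℕ n + fromℕ (n ℕ./ E)            ≤⟨ +-monoʳ-≤ (fromℕ n) spare ⟩
      fromℕ n + ε * fromℕ n                ≡⟨ cong (_+ ε * fromℕ n) (sym (*-identityˡ (fromℕ n))) ⟩
      1# * fromℕ n + ε * fromℕ n           ≡⟨ sym (distribʳ (fromℕ n) 1# ε) ⟩
      (1# + ε) * fromℕ n                   ∎
      where
      spare : fromℕ (n ℕ./ E) ≤ ε * fromℕ n
      spare = begin
        fromℕ (n ℕ./ E)                    ≡⟨ sym (*-identityʳ _) ⟩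
        fromℕ (n ℕ./ E) * 1#               ≤⟨ *-monoˡ (fromℕ≥0 (n ℕ./ E)) 1≤εE ⟩
        fromℕ (n ℕ./ E) * (ε * fromℕ E)    ≡⟨ solve 3 (λ a b c → a :* (b :* c) := b :* (a :* c)) refl (fromℕ (n ℕ./ E)) ε (fromℕ E) ⟩
        ε * (fromℕ (n ℕ./ E) * fromℕ E)    ≡⟨ cong (ε *_) (sym (fromℕ-* (n ℕ./ E) E)) ⟩
        ε * fromℕ (n ℕ./ E ℕ.* E)          ≤⟨ *-monoˡ ε≥0 (fromℕ-mono-≤ (ℕ.m/n*n≤m n E)) ⟩
        ε * fromℕ n                        ∎

    E≤2/ε : fromℕ E ≤ fromℕ 2 * ε ⁻¹
    E≤2/ε = begin
      fromℕ E                       ≡⟨ sym (*-identityʳ _) ⟩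
      fromℕ E * 1#                  ≡⟨ cong (fromℕ E *_) (sym (*-inverseʳ ε ε≢0)) ⟩
      fromℕ E * (ε * ε ⁻¹)          ≡⟨ solve 3 (λ a b c → a :* (b :* c) := (b :* a) :* c) refl (fromℕ E) ε (ε ⁻¹) ⟩
      ε * fromℕ E * ε ⁻¹            ≤⟨ *-monoʳ (inv≥0 ε≥0 ε≢0) εE≤2 ⟩
      fromℕ 2 * ε ⁻¹                ∎

    -- 1536 is 768 times the factor 2 from `E ≤ 2 / ε`.
    ratio : fromℕ (proj₁ scheme) ≤ fromℕ 1536 * (L ^ 3 / ε)
    ratio = begin
      fromℕ (proj₁ scheme)                                ≤⟨ fromℕ-mono-≤ (proj₁ (proj₂ scheme)) ⟩
      fromℕ (768 ℕ.* (E ℕ.* (N ℕ.* (N ℕ.* N))))           ≡⟨ fromℕ-* 768 (E ℕ.* (N ℕ.* (N ℕ.* N))) ⟩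
      fromℕ 768 * fromℕ (E ℕ.* (N ℕ.* (N ℕ.* N)))         ≡⟨ cong (fromℕ 768 *_) (trans (fromℕ-* E (N ℕ.* (N ℕ.* N))) (cong (fromℕ E *_)
                                                               (trans (fromℕ-* N (N ℕ.* N)) (cong (fromℕ N *_) (fromℕ-* N N))))) ⟩
      fromℕ 768 * (fromℕ E * (fromℕ N * (fromℕ N * fromℕ N))) ≤⟨ *-monoˡ (fromℕ≥0 768) (*-mono-≤
                                                               (≤-trans (fromℕ≥0 E) E≤2/ε) (*-nonNeg (fromℕ≥0 N) (*-nonNeg (fromℕ≥0 N) (fromℕ≥0 N)))
                                                               E≤2/ε (^3-mono-≤ (fromℕ≥0 N) N≤L)) ⟩
      fromℕ 768 * (fromℕ 2 * ε ⁻¹ * L ^ 3)                ≡⟨ solve 4 (λ a b c d → a :* (b :* c :* d) := a :* b :* (d :* c)) refl (fromℕ 768) (fromℕ 2) (ε ⁻¹) (L ^ 3) ⟩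
      fromℕ 768 * fromℕ 2 * (L ^ 3 / ε)                   ≡⟨ cong (_* (L ^ 3 / ε)) (sym (fromℕ-* 768 2)) ⟩
      fromℕ 1536 * (L ^ 3 / ε)                            ∎

theorem7p1 : (R : RealNumbers) → let open OnlineSorting R in
    ∃ λ (K : ℝ) → 0# < K ×
    (∀ (n : ℕ) → 2 ℕ.≤ n →
    ∀ (ε : ℝ) → (fromℕ 3 * log₂ n) / fromℕ n ≤ ε → ε ≤ 1# →
    ∃ λ (m : ℕ) → fromℕ m ≤ (1# + ε) * fromℕ n ×
    ∃ λ (alg : Algorithm m) →
    Competitive n alg (K * (log₂ n ^ 3 / ε)))
theorem7p1 R = fromℕ 1536 , 0<fromℕ-suc 1535 , competitive
  where
  open OrderedField R
  open Competitiveness R
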